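{- Let $(\mathbb A,\mathbb B)$ and $(\mathbb A',\mathbb B')$ be PCSP templates with polymorphism minions $\mathcal M=\mathrm{Pol}(\mathbb A,\mathbb B)$ and $\mathcal M'=\mathrm{Pol}(\mathbb A',\mathbb B')$, and let $k\in\mathbb N$. Then $\mathrm{PCSP}(\mathbb A',\mathbb B')$ reduces to $\mathrm{PCSP}(\mathbb A,\mathbb B)$ via the $k$-consistency reduction (defined using the $k$-th saturated power) if and only if there is a minion homomorphism from $\mathrm{lvl}_k(\omega\mathcal M)$ to $\mathcal M'$.
   Context: An LC (label cover) instance $\mathcal D$ consists of a finite set $X$ of variables, a finite set $\mathcal D_x$ (domain) for each $x\in X$, and a finite list of constraints of the form $x=\alpha(y)$ with $x,y\in X$ and $\alpha:\mathcal D_y\to\mathcal D_x$ a function; it is discrete if it has no constraints. A minion $\mathcal R$ is a functor from finite sets to sets: it assigns a set $\mathcal R^{(D)}$ to each finite set $D$ and a map $\mathcal R^{(\alpha)}:\mathcal R^{(D)}\to\mathcal R^{(E)}$ to each function $\alpha:D\to E$ between finite sets, preserving identities and composition. A solution of $\mathcal D$ in $\mathcal R$ is a tuple $(r_x)_{x\in X}$ with $r_x\in\mathcal R^{(\mathcal D_x)}$ and $r_x=\mathcal R^{(\alpha)}(r_y)$ for every constraint $x=\alpha(y)$ of $\mathcal D$. A minion homomorphism $\mathcal R\to\mathcal S$ is a family of functions $\xi^{(D)}:\mathcal R^{(D)}\to\mathcal S^{(D)}$, indexed by all finite sets $D$, with $\xi^{(E)}\circ\mathcal R^{(\alpha)}=\mathcal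 S^{(\alpha)}\circ\xi^{(D)}$ for every $\alpha:D\to E$. The $k$-th saturated power $\mathrm{pow}_k\,\mathcal D$ is the LC instance with variable set $X^k$, domains $\mathcal D_{x_1x_2\dots x_k}=\mathcal D_{x_1}\times\cdots\times\mathcal D_{x_k}$, and the following constraints, where first all constraints $x=\mathrm{id}(x)$ ($x\in X$) are added to $\mathcal D$: (1) for every $k$-tuple of constraints $x_i=\alpha_i(y_i)$, $i=1,\dots,k$, of $\mathcal D$, the constraint $x_1\dots x_k=(\alpha_1\times\cdots\times\alpha_k)(y_1\dots y_k)$; (2) for every $x_1\dots x_k\in X^k$ and every function $\sigma:[k]\to[k]$, the constraint $x_{\sigma(1)}\dots x_{\sigma(k)}=\sigma^*(x_1\dots x_k)$, where $\sigma^*(d_1\dots d_k)=d_{\sigma(1)}\dots d_{\sigma(k)}$. The $k$-th level $\mathrm{lvl}_k\,\mathcal R$ of a minion $\mathcal R$ is defined as follows. Elements of $(\mathrm{lvl}_k\,\mathcal R)^{(C)}$ are triples $(\mathcal E,r,w)$ where $\mathcal E$ is a discrete LC instance with variable set $Y$; $r=(r_{\bar y})_{\bar y\in Y^k}$ is a solution of $\mathrm{pow}_k\,\mathcal E$ in $\mathcal R$; and $w=(w_{\bar y})_{\bar y\in Y^{k-1}}$ is a tuple with $w_{\bar y}\in\mathcal R^{(C\times\mathcal E_{y_1}\times\cdots\times\mathcal E_{y_{k-1}})}$ such that there exist $z\in Y$ and a map $\beta:\mathcal E_z\to C$ with $w_{\bar y}=\mathcal R^{(\beta\times\mathrm{id}\times\cdots\times\mathrm{id})}(r_{zy_1\dots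 y_{k-1}})$ for all $\bar y\in Y^{k-1}$. For $\alpha:C\to C'$, $(\mathrm{lvl}_k\,\mathcal R)^{(\alpha)}(\mathcal E,r,w)=(\mathcal E,r,w')$ with $w'_{\bar y}=\mathcal R^{(\alpha\times\mathrm{id}\times\cdots\times\mathrm{id})}(w_{\bar y})$. For a minion $\mathcal R$, $d\in D$ and $r\in\mathcal R^{(D)}$, we say that $d$ is dummy in $r$ (a dummy of $r$) if there are a map $\alpha:D''\to D$ and $r''\in\mathcal R^{(D'')}$ such that $d$ is not in the image of $\alpha$ and $r=\mathcal R^{(\alpha)}(r'')$. The minion $\omega\mathcal R$: $(\omega\mathcal R)^{(D)}$ is the set of pairs $(D',r)$ where $D'\subseteq D$, $r\in\mathcal R^{(D)}$, and all elements $d\in D\setminus D'$ are dummies of $r$; for $\alpha:D\to E$, $(\omega\mathcal R)^{(\alpha)}(D',r)=(\alpha(D'),\mathcal R^{(\alpha)}(r))$. A structure $\mathbb A$ in a signature $\Sigma$ (a set of relation symbols $R$ with arities $\mathrm{ar}(R)\in\mathbb N$) consists of a finite set $A$ and a relation $R^{\mathbb A}\subseteq A^{\mathrm{ar}(R)}$ for each $R\in\Sigma$. A homomorphism is a relation-preserving map. A PCSP template is a pair $(\mathbb A,\mathbb B)$ of structures in the same finite signature such that there is a homomorphism $\mathbb A\to\mathbb B$ (the two templates in the claim may have different signatures). An instance $\mathcal I$ of $\mathrm{PCSP}(\mathbb A,\mathbb B)$ is a list of formal constraints $x_1\dots x_n\in R$ with $R\in\Sigma$, $n=\mathrm{ar}(R)$,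 and $x_i$ variables. A solution of $\mathcal I$ in $\mathbb B$ is a map $s$ from variables to $B$ with $s(x_1)\dots s(x_n)\in R^{\mathbb B}$ for each constraint (similarly for $\mathbb A$); the task is to distinguish instances solvable in $\mathbb A$ from those not even solvable in $\mathbb B$. The LC instance $\mathrm{lc}_{\mathbb A}(\mathcal I)$ has as variables the variables of $\mathcal I$, each with domain $A$, together with one variable $y$ with domain $R^{\mathbb A}$ for each constraint $x_1\dots x_n\in R$ of $\mathcal I$, with LC constraints $x_i=\pi_i(y)$, $i=1,\dots,n$, where $\pi_i$ is the $i$-th projection. The polymorphism minion $\mathcal M=\mathrm{Pol}(\mathbb A,\mathbb B)$: $\mathcal M^{(D)}$ is the set of homomorphisms from the Cartesian power $\mathbb A^D$ to $\mathbb B$; for $\alpha:D\to E$ and $f\in\mathcal M^{(D)}$, $\mathcal M^{(\alpha)}(f):\mathbb A^E\to\mathbb B$ is $a\mapsto f(a\circ\alpha)$. For an LC instance $\mathcal D$, $\mathrm{arc}(\mathcal D)$ is the LC instance obtained by replacing the domains $\mathcal D_x$ with the largest subsets $\mathcal D'_x\subseteq\mathcal D_x$ such that $\mathcal D'_x=\alpha(\mathcal D'_y)$ for every constraint $x=\alpha(y)$ of $\mathcal D$, and restricting the constraint maps accordingly. For an LC instance $\mathcal D$ with variable set $X$, $\mathrm{csp}_{\mathbb A}(\mathcal D)$ denotes the standard reduction from label cover to instances of $\mathrm{PCSP}(\mathbb A,\mathbb B)$: its variables are the pairs $(x,a)$ with $x\in X$, $a\in A^{\mathcal D_x}$, modulo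 the equivalence relation generated by $(x,a)\sim(y,a\circ\alpha)$ for every constraint $x=\alpha(y)$ of $\mathcal D$ and every $a\in A^{\mathcal D_x}$; its constraints are $(x,a_1)\dots(x,a_n)\in R$ for every symbol $R$ of arity $n$, every $x\in X$, and all $a_1,\dots,a_n\in A^{\mathcal D_x}$ with $a_1(d)\dots a_n(d)\in R^{\mathbb A}$ for all $d\in\mathcal D_x$. (Solutions of $\mathcal D$ in $\mathrm{Pol}(\mathbb A,\mathbb B)$ are in one-to-one correspondence with solutions of $\mathrm{csp}_{\mathbb A}(\mathcal D)$ in $\mathbb B$.) The $k$-consistency reduction (defined using the $k$-th saturated power) maps an instance $\mathcal I$ of $\mathrm{PCSP}(\mathbb A',\mathbb B')$ to $\mathcal I^\sharp=\mathrm{csp}_{\mathbb A}(\mathrm{arc}(\mathrm{pow}_k\,\mathrm{lc}_{\mathbb A'}(\mathcal I)))$. $\mathrm{PCSP}(\mathbb A',\mathbb B')$ reduces to $\mathrm{PCSP}(\mathbb A,\mathbb B)$ via it if for every instance $\mathcal I$ of $\mathrm{PCSP}(\mathbb A',\mathbb B')$: if $\mathcal I$ has a solution in $\mathbb A'$, then $\mathcal I^\sharp$ has a solution in $\mathbb A$; and if $\mathcal I^\sharp$ has a solution in $\mathbb B$, then $\mathcal I$ has a solution in $\mathbb B'$.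
   Formalization: In the definition of ωR, pairs (∅,r) must also have r coming from R^(∅); without this ωM need not be closed under maps (e.g. when a relation of A is empty), and it is automatic whenever the literal pairs form a minion. Also k ≥ 1. -}

module Defs where

open import Data.Bool.Base using (Bool; true; false; T)
open import Data.Bool.Properties using (T?; T-≡; T-irrelevant; ⇔→≡) renaming (_≟_ to _≟ᵇ_)
open import Data.Empty using (⊥; ⊥-elim)
open import Data.Fin.Base using (Fin; zero; suc)
import Data.Fin.Properties as Fin
open import Data.Fin.Subset using (Subset)
open import Data.Fin.Subset.Properties using (anySubset?)
open import Data.List.Base as List using (List; []; _∷_)
open import Data.List.Membership.Propositional using (_∈_)
open import Data.List.Membership.Propositional.Properties using (∈-map⁺; ∈-allFin)
open import Data.List.Relation.Unary.Any using (here; there)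
open import Data.Nat.Base using (ℕ; zero; suc; _+_; _*_; _^_; NonZero)
open import Data.Product.Base using (Σ; ∃; Σ-syntax; _×_; _,_; proj₁; proj₂; map₁)
open import Data.Product.Function.Dependent.Propositional using (Σ-↔)
open import Data.Product.Function.NonDependent.Propositional using (_×-↔_)
open import Data.Sum.Base using (_⊎_; inj₁; inj₂; [_,_]′)
open import Data.Sum.Function.Propositional using (_⊎-↔_)
open import Data.Unit.Base using (⊤; tt)
open import Data.Vec.Base as Vec using (Vec; []; _∷_; lookup; tabulate)
open import Data.Vec.Properties using (lookup∘tabulate; tabulate∘lookup; tabulate-cong)
import Data.Vec.Properties as Vecₚ
open import Function.Base using (id; _∘_; const; case_of_)
open import Function.Bundles using (_↔_; _⇔_; Inverse; Equivalence; mk↔ₛ′; mk⇔)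
open import Function.Construct.Composition using (_↔-∘_)
open import Function.Construct.Identity using (↔-id)
open import Function.Construct.Symmetry using (↔-sym)
open import Level using (Level; 0ℓ; _⊔_) renaming (suc to lsuc)
open import Relation.Binary.Bundles using (Setoid)
open import Relation.Binary.Construct.Closure.Equivalence using (EqClosure)
import Relation.Binary.Construct.Closure.Equivalence as EqC
open import Relation.Binary.PropositionalEquality
  using (_≡_; _≢_; _≗_; refl; sym; trans; cong; subst)
import Relation.Binary.PropositionalEquality as ≡
open import Relation.Nullary.Decidable
  using (Dec; yes; no; isYes; toWitness; fromWitness; _×-dec_; map′)
open import Relation.Nullary.Negation using (¬_; contradiction)
open import Relation.Unary using (Decidable)

record FinSet : Set₁ where
  field
    Carrier : Set
    size    : ℕ
    enum    : Carrier ↔ Fin size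

  index : Carrier → Fin size
  index = Inverse.to enum

  element : Fin size → Carrier
  element = Inverse.from enum

  index-element : ∀ i → index (element i) ≡ i
  index-element = Inverse.strictlyInverseˡ enum

  element-index : ∀ x → element (index x) ≡ x
  element-index = Inverse.strictlyInverseʳ enum

  index-injective : ∀ {x y} → index x ≡ index y → x ≡ y
  index-injective {x} {y} eq =
    trans (sym (element-index x)) (trans (cong element eq) (element-index y))

  _≟_ : (x y : Carrier) → Dec (x ≡ y)
  x ≟ y = map′ index-injective (cong index) (index x Fin.≟ index y)

  any? : ∀ {p} {P : Carrier → Set p} → Decidable P → Dec (∃ P)
  any? {P = P} P? = map′ (λ (i , p) → element i , p)
                         (λ (x , p) → index x , subst P (sym (element-index x)) p)
                         (Fin.any? (P? ∘ element))

  all? : ∀ {p} {P : Carrier → Set p} → Decidable P → Dec (∀ x → P x)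
  all? {P = P} P? = map′ (λ f x → subst P (element-index x) (f (index x)))
                         (λ f → f ∘ element)
                         (Fin.all? (P? ∘ element))

  elements : List Carrier
  elements = List.map element (List.allFin size)

  ∈-elements : ∀ x → x ∈ elements
  ∈-elements x = subst (_∈ elements) (element-index x) (∈-map⁺ element (∈-allFin (index x)))

∣_∣ : FinSet → Set
∣_∣ = FinSet.Carrier

Finᶠ : ℕ → FinSet
Finᶠ n = record { Carrier = Fin n ; size = n ; enum = ↔-id _ }

𝟘 𝟙 : FinSet
𝟘 = record { Carrier = ⊥ ; size = 0 ; enum = ↔-sym Fin.0↔⊥ }
𝟙 = record { Carrier = ⊤ ; size = 1 ; enum = ↔-sym Fin.1↔⊤ }

infixr 2 _×ᶠ_
infixr 1 _⊎ᶠ_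

_⊎ᶠ_ : FinSet → FinSet → FinSet
D ⊎ᶠ E = record
  { Carrier = ∣ D ∣ ⊎ ∣ E ∣
  ; size    = FinSet.size D + FinSet.size E
  ; enum    = ↔-sym Fin.+↔⊎ ↔-∘ (FinSet.enum D ⊎-↔ FinSet.enum E)
  }

_×ᶠ_ : FinSet → FinSet → FinSet
D ×ᶠ E = record
  { Carrier = ∣ D ∣ × ∣ E ∣
  ; size    = FinSet.size D * FinSet.size E
  ; enum    = ↔-sym Fin.*↔× ↔-∘ (FinSet.enum D ×-↔ FinSet.enum E)
  }

private
  ΣFin : ∀ n (P : Fin n → FinSet) → ∃ λ m → Σ (Fin n) (∣_∣ ∘ P) ↔ Fin m
  ΣFin zero    P = 0 , mk↔ₛ′ proj₁ (λ ()) (λ ()) (λ ())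
  ΣFin (suc n) P = let (m , tail) = ΣFin n (P ∘ suc) in
    FinSet.size (P zero) + m , ↔-sym Fin.+↔⊎ ↔-∘ ((FinSet.enum (P zero) ⊎-↔ tail) ↔-∘ split)
    where
    split : Σ (Fin (suc n)) (∣_∣ ∘ P) ↔ (∣ P zero ∣ ⊎ Σ (Fin n) (∣_∣ ∘ P ∘ suc))
    split = mk↔ₛ′
      (λ { (zero , p) → inj₁ p ; (suc i , p) → inj₂ (i , p) })
      (λ { (inj₁ p) → zero , p ; (inj₂ (i , p)) → suc i , p })
      (λ { (inj₁ _) → refl ; (inj₂ _) → refl })
      (λ { (zero , _) → refl ; (suc _ , _) → refl })

Σᶠ : (D : FinSet) → (∣ D ∣ → FinSet) → FinSet
Σᶠ D P = record
  { Carrier = Σ ∣ D ∣ (∣_∣ ∘ P)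
  ; size    = proj₁ fibres
  ; enum    = proj₂ fibres ↔-∘ ↔-sym (Σ-↔ (↔-sym (FinSet.enum D)) (↔-id _))
  }
  where
  fibres : ∃ λ m → Σ (Fin (FinSet.size D)) (∣_∣ ∘ P ∘ FinSet.element D) ↔ Fin m
  fibres = ΣFin (FinSet.size D) (P ∘ FinSet.element D)

Vecᶠ : FinSet → ℕ → FinSet
Vecᶠ D n = record
  { Carrier = Vec ∣ D ∣ n ; size = FinSet.size D ^ n ; enum = vec n }
  where
  vec : ∀ n → Vec ∣ D ∣ n ↔ Fin (FinSet.size D ^ n)
  vec zero    = mk↔ₛ′ (λ _ → zero) (λ _ → []) (λ { zero → refl }) (λ { [] → refl })
  vec (suc n) = (↔-sym Fin.*↔× ↔-∘ (FinSet.enum D ×-↔ vec n)) ↔-∘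
    mk↔ₛ′ Vec.uncons (λ (x , xs) → x ∷ xs) (λ _ → refl) (λ { (_ ∷ _) → refl })

-- Subsets of a finite set are Bool-valued functions; `sub D S` is the
-- subset S as a finite set in its own right.
sub : (D : FinSet) → (∣ D ∣ → Bool) → FinSet
sub D S = Σᶠ D (truth ∘ S)
  where
  truth : Bool → FinSet
  truth b = record { Carrier = T b ; size = _ ; enum = proj₂ (count b) }
    where
    count : ∀ b → ∃ λ n → T b ↔ Fin n
    count true  = 1 , ↔-sym Fin.1↔⊤
    count false = 0 , ↔-sym Fin.0↔⊥

sub-≡ : ∀ {D S} {x y : ∣ sub D S ∣} → proj₁ x ≡ proj₁ y → x ≡ y
sub-≡ {x = _ , p} {_ , q} refl = cong (_ ,_) (T-irrelevant p q)

abstract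

  image : ∀ {D E : FinSet} → (∣ D ∣ → ∣ E ∣) → (∣ D ∣ → Bool) → ∣ E ∣ → Bool
  image {D} {E} α S e = isYes (FinSet.any? D (λ d → T? (S d) ×-dec FinSet._≟_ E (α d) e))

  ∈-image⁺ : ∀ {D E : FinSet} {α : ∣ D ∣ → ∣ E ∣} {S : ∣ D ∣ → Bool} →
             ∀ d → T (S d) → T (image {D} {E} α S (α d))
  ∈-image⁺ {D} {E} {α} {S} d p =
    fromWitness {a? = FinSet.any? D (λ d′ → T? (S d′) ×-dec FinSet._≟_ E (α d′) (α d))} (d , p , refl)

  ∈-image⁻ : ∀ {D E : FinSet} {α : ∣ D ∣ → ∣ E ∣} {S : ∣ D ∣ → Bool} →
             ∀ e → T (image {D} {E} α S e) → ∃ λ d → T (S d) × α d ≡ e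
  ∈-image⁻ {D} {E} {α} {S} e =
    toWitness {a? = FinSet.any? D (λ d → T? (S d) ×-dec FinSet._≟_ E (α d) e)}

T-ext : ∀ {b c} → (T b → T c) → (T c → T b) → b ≡ c
T-ext f g = ⇔→≡ {z = true} (mk⇔
  (Equivalence.to T-≡ ∘ f ∘ Equivalence.from T-≡)
  (Equivalence.to T-≡ ∘ g ∘ Equivalence.from T-≡))

image-mono : ∀ {D E : FinSet} {α β : ∣ D ∣ → ∣ E ∣} {S S′ : ∣ D ∣ → Bool} → α ≗ β →
             (∀ d → T (S d) → T (S′ d)) → ∀ e → T (image {D} {E} α S e) → T (image {D} {E} β S′ e)
image-mono {D} {E} {α} {β} {S} {S′} α≗β S⊆S′ e p = case ∈-image⁻ {D} {E} {α} {S} e p of λ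
  { (d , q , refl) → subst (T ∘ image {D} {E} β S′) (sym (α≗β d))
                       (∈-image⁺ {D} {E} {β} {S′} d (S⊆S′ d q)) }

image-cong : ∀ {D E : FinSet} {α β : ∣ D ∣ → ∣ E ∣} {S S′ : ∣ D ∣ → Bool} → α ≗ β → S ≗ S′ →
             image {D} {E} α S ≗ image {D} {E} β S′
image-cong {D} {E} α≗β S≗S′ e = T-ext
  (image-mono {D} {E} α≗β (λ d → subst T (S≗S′ d)) e)
  (image-mono {D} {E} (λ d → sym (α≗β d)) (λ d → subst T (sym (S≗S′ d))) e)

image-id : ∀ {D : FinSet} (S : ∣ D ∣ → Bool) → image {D} {D} id S ≗ S
image-id {D} S d = T-ext
  (λ p → case ∈-image⁻ {D} {D} {id} {S} d p of λ { (_ , q , refl) → q })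
  (∈-image⁺ {D} {D} {id} {S} d)

image-∘ : ∀ {D E F : FinSet} (β : ∣ E ∣ → ∣ F ∣) (α : ∣ D ∣ → ∣ E ∣) (S : ∣ D ∣ → Bool) →
          image {D} {F} (β ∘ α) S ≗ image {E} {F} β (image {D} {E} α S)
image-∘ {D} {E} {F} β α S f = T-ext
  (λ p → case ∈-image⁻ {D} {F} {β ∘ α} {S} f p of λ
    { (d , q , refl) → ∈-image⁺ {E} {F} {β} (α d) (∈-image⁺ {D} {E} {α} {S} d q) })
  (λ p → case ∈-image⁻ {E} {F} {β} f p of λ
    { (e , q , refl) → case ∈-image⁻ {D} {E} {α} {S} e q of λ
      { (d , r , refl) → ∈-image⁺ {D} {F} {β ∘ α} {S} d r } })

-- The finite set A^D.  Functions D → A are represented by their tables,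
-- so that propositional equality of elements is extensional equality.
infixr 4 _⇒ᶠ_

_⇒ᶠ_ : FinSet → FinSet → FinSet
D ⇒ᶠ A = Vecᶠ A (FinSet.size D)

module _ {D A : FinSet} where

  apply : ∣ D ⇒ᶠ A ∣ → ∣ D ∣ → ∣ A ∣
  apply a d = lookup a (FinSet.index D d)

  table : (∣ D ∣ → ∣ A ∣) → ∣ D ⇒ᶠ A ∣
  table f = tabulate (f ∘ FinSet.element D)

  apply-table : ∀ f → apply (table f) ≗ f
  apply-table f d = trans (lookup∘tabulate _ (FinSet.index D d)) (cong f (FinSet.element-index D d))

  table-apply : ∀ a → table (apply a) ≡ a
  table-apply a = trans (tabulate-cong (λ i → cong (lookup a) (FinSet.index-element D i)))
                        (tabulate∘lookup a)

  table-cong : ∀ {f g} → f ≗ g → table f ≡ table g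
  table-cong f≗g = tabulate-cong (f≗g ∘ FinSet.element D)

precompose : ∀ {D E A : FinSet} → (∣ D ∣ → ∣ E ∣) → ∣ E ⇒ᶠ A ∣ → ∣ D ⇒ᶠ A ∣
precompose {D} {E} {A} α a = table {D} {A} (apply {E} {A} a ∘ α)

-- The quotient of V by the equivalence relation generated by the pairs
-- (l g , r g).
module _ {V : FinSet} {G : Set} (l r : G → ∣ V ∣) where

  Generator : ∣ V ∣ → ∣ V ∣ → Set
  Generator u v = ∃ λ g → l g ≡ u × r g ≡ v

record Quotient (V : FinSet) (_∼_ : ∣ V ∣ → ∣ V ∣ → Set) : Set₁ where
  field
    quotient : FinSet
    [_]      : ∣ V ∣ → ∣ quotient ∣
    rep      : ∣ quotient ∣ → ∣ V ∣
    [rep]    : ∀ q → [ rep q ] ≡ q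
    sound    : ∀ {u v} → EqClosure _∼_ u v → [ u ] ≡ [ v ]
    complete : ∀ {u v} → [ u ] ≡ [ v ] → EqClosure _∼_ u v

-- Every element is relabelled by a representative of its class; the
-- classes of l g and r g are merged for one g after the other.
abstract

  generatedQuotient : ∀ (V G : FinSet) (l r : ∣ G ∣ → ∣ V ∣) → Quotient V (Generator {V} l r)
  generatedQuotient V G l r = record
    { quotient = sub V isRep
    ; [_]      = λ v → label gs v , fromWitness (label-idem gs v)
    ; rep      = proj₁
    ; [rep]    = λ (v , p) → sub-≡ {V} {isRep} (toWitness p)
    ; sound    = λ c → sub-≡ {V} {isRep} (EqC.gfold ≡.isEquivalence (label gs) sound₁ c)
    ; complete = λ eq → complete gs (cong proj₁ eq)
    }
    where
    open FinSet V using (_≟_)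
    gs : List ∣ G ∣
    gs = FinSet.elements G

    label : List ∣ G ∣ → ∣ V ∣ → ∣ V ∣
    label []       v = v
    label (g ∷ gs) v with label gs v ≟ label gs (l g)
    ... | yes _ = label gs (r g)
    ... | no  _ = label gs v

    isRep : ∣ V ∣ → Bool
    isRep v = isYes (label gs v ≟ v)

    label-idem : ∀ gs v → label gs (label gs v) ≡ label gs v
    label-idem []       v = refl
    label-idem (g ∷ gs) v with label gs v ≟ label gs (l g)
    ... | yes _ with label gs (label gs (r g)) ≟ label gs (l g)
    ...   | yes _ = refl
    ...   | no  _ = label-idem gs (r g)
    label-idem (g ∷ gs) v | no ¬p with label gs (label gs v) ≟ label gs (l g)
    ...   | yes q = contradiction (trans (sym (label-idem gs v)) q) ¬p
    ...   | no  _ = label-idem gs v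

    label-cong : ∀ g gs {u v} → label gs u ≡ label gs v → label (g ∷ gs) u ≡ label (g ∷ gs) v
    label-cong g gs {u} {v} eq with label gs u ≟ label gs (l g) | label gs v ≟ label gs (l g)
    ... | yes _ | yes _ = refl
    ... | yes p | no ¬q = contradiction (trans (sym eq) p) ¬q
    ... | no ¬p | yes q = contradiction (trans eq q) ¬p
    ... | no  _ | no  _ = eq

    merged : ∀ {g} gs → g ∈ gs → label gs (l g) ≡ label gs (r g)
    merged (g ∷ gs) (there i) = label-cong g gs (merged gs i)
    merged (g ∷ gs) (here refl) with label gs (l g) ≟ label gs (l g) | label gs (r g) ≟ label gs (l g)
    ... | yes _ | yes _ = refl
    ... | yes _ | no  _ = refl
    ... | no ¬p | _     = contradiction refl ¬p

    sound₁ : ∀ {u v} → Generator {V} l r u v → label gs u ≡ label gs v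
    sound₁ (g , refl , refl) = merged gs (FinSet.∈-elements G g)

    _≈_ : ∣ V ∣ → ∣ V ∣ → Set
    _≈_ = EqClosure (Generator {V} l r)

    toLabel : ∀ gs v → v ≈ label gs v
    toLabel []       v = EqC.reflexive _
    toLabel (g ∷ gs) v with label gs v ≟ label gs (l g)
    ... | no  _ = toLabel gs v
    ... | yes p = EqC.transitive _ (subst (v ≈_) p (toLabel gs v))
                 (EqC.transitive _ (EqC.symmetric _ (toLabel gs (l g)))
                 (EqC.transitive _ (EqC.return (g , refl , refl)) (toLabel gs (r g))))

    complete : ∀ gs {u v} → label gs u ≡ label gs v → u ≈ v
    complete gs {u} {v} eq =
      EqC.transitive _ (subst (u ≈_) eq (toLabel gs u)) (EqC.symmetric _ (toLabel gs v))

record Minion (c ℓ : Level) : Set (lsuc (0ℓ ⊔ c ⊔ ℓ)) where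
  field
    obj      : FinSet → Setoid c ℓ
    map      : ∀ {D E} → (∣ D ∣ → ∣ E ∣) → Setoid.Carrier (obj D) → Setoid.Carrier (obj E)

  Elem : FinSet → Set c
  Elem D = Setoid.Carrier (obj D)

  infix 4 _≈_
  _≈_ : ∀ {D} → Elem D → Elem D → Set ℓ
  _≈_ {D} = Setoid._≈_ (obj D)

  field
    map-cong : ∀ {D E} {α β : ∣ D ∣ → ∣ E ∣} {r s : Elem D} → α ≗ β → r ≈ s →
               map {D} {E} α r ≈ map β s
    map-id   : ∀ {D} (r : Elem D) → map {D} {D} id r ≈ r
    map-∘    : ∀ {D E F} (β : ∣ E ∣ → ∣ F ∣) (α : ∣ D ∣ → ∣ E ∣) (r : Elem D) →
               map {D} {F} (β ∘ α) r ≈ map {E} {F} β (map {D} {E} α r)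

  module ≈ {D} = Setoid (obj D)

record MinionHom {c ℓ c′ ℓ′} (R : Minion c ℓ) (S : Minion c′ ℓ′) :
                 Set (lsuc 0ℓ ⊔ c ⊔ ℓ ⊔ c′ ⊔ ℓ′) where
  private
    module R = Minion R
    module S = Minion S
  field
    ξ         : ∀ D → R.Elem D → S.Elem D
    ξ-cong    : ∀ {D} {r s : R.Elem D} → r R.≈ s → ξ D r S.≈ ξ D s
    ξ-natural : ∀ {D E} (α : ∣ D ∣ → ∣ E ∣) (r : R.Elem D) →
                ξ E (R.map {D} {E} α r) S.≈ S.map {D} {E} α (ξ D r)

-- The finite list of constraints is a family indexed by a finite set:
-- c stands for lhs c = fun c (rhs c).
record LC : Set₁ where
  field
    Var : FinSet
    Dom : ∣ Var ∣ → FinSet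
    Con : FinSet
    lhs : ∣ Con ∣ → ∣ Var ∣
    rhs : ∣ Con ∣ → ∣ Var ∣
    fun : ∀ c → ∣ Dom (rhs c) ∣ → ∣ Dom (lhs c) ∣

Discrete : LC → Set
Discrete 𝒟 = ¬ ∣ LC.Con 𝒟 ∣

Assignment : ∀ {c ℓ} → LC → Minion c ℓ → Set c
Assignment 𝒟 R = ∀ x → Minion.Elem R (LC.Dom 𝒟 x)

IsSolution : ∀ {c ℓ} (𝒟 : LC) (R : Minion c ℓ) → Assignment 𝒟 R → Set ℓ
IsSolution 𝒟 R r = ∀ c → r (lhs c) ≈ map {Dom (rhs c)} {Dom (lhs c)} (fun c) (r (rhs c))
  where open LC 𝒟; open Minion R

withIdentities : LC → LC
withIdentities 𝒟 = record
  { Var = Var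
  ; Dom = Dom
  ; Con = Con ⊎ᶠ Var
  ; lhs = [ lhs , id ]′
  ; rhs = [ rhs , id ]′
  ; fun = λ { (inj₁ c) → fun c ; (inj₂ x) → id }
  }
  where open LC 𝒟

Π : ∀ {X : Set} {n} → (X → FinSet) → Vec X n → FinSet
Π D []       = 𝟙
Π D (x ∷ xs) = D x ×ᶠ Π D xs

module _ {X : Set} {D : X → FinSet} where

  component : ∀ {n} (xs : Vec X n) → ∣ Π D xs ∣ → (i : Fin n) → ∣ D (lookup xs i) ∣
  component (x ∷ xs) (d , ds) zero    = d
  component (x ∷ xs) (d , ds) (suc i) = component xs ds i

  -- A function σ : [m] → [n] is given by the vector σ(1) … σ(m).
  reindex : ∀ {m n} (σ : Vec (Fin n) m) (xs : Vec X n) → ∣ Π D xs ∣ → ∣ Π D (Vec.map (lookup xs) σ) ∣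
  reindex []      xs ds = tt
  reindex (i ∷ σ) xs ds = component xs ds i , reindex σ xs ds

funs : ∀ (𝒟 : LC) (let open LC 𝒟) {n} (cs : Vec ∣ Con ∣ n) →
       ∣ Π Dom (Vec.map rhs cs) ∣ → ∣ Π Dom (Vec.map lhs cs) ∣
funs 𝒟 []       tt       = tt
funs 𝒟 (c ∷ cs) (d , ds) = LC.fun 𝒟 c d , funs 𝒟 cs ds

pow : ℕ → LC → LC
pow k 𝒟 = record
  { Var = Vecᶠ Var k
  ; Dom = Π Dom
  ; Con = Vecᶠ Con k ⊎ᶠ (Vecᶠ Var k ×ᶠ Vecᶠ (Finᶠ k) k)
  ; lhs = λ { (inj₁ cs) → Vec.map lhs cs ; (inj₂ (xs , σ)) → Vec.map (lookup xs) σ }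
  ; rhs = λ { (inj₁ cs) → Vec.map rhs cs ; (inj₂ (xs , σ)) → xs }
  ; fun = λ { (inj₁ cs) → funs 𝒟ᵢ cs ; (inj₂ (xs , σ)) → reindex σ xs }
  }
  where
  𝒟ᵢ : LC
  𝒟ᵢ = withIdentities 𝒟
  open LC 𝒟ᵢ

module _ (𝒟 : LC) where
  open LC 𝒟

  Subdomains : Set
  Subdomains = ∀ x → ∣ Dom x ∣ → Bool

  ArcConsistent : Subdomains → Set
  ArcConsistent S = ∀ c → S (lhs c) ≗ image {Dom (rhs c)} {Dom (lhs c)} (fun c) (S (rhs c))

  private
    Labels : FinSet
    Labels = Σᶠ Var Dom

    decode : Subset (FinSet.size Labels) → Subdomains
    decode V x d = lookup V (FinSet.index Labels (x , d))

    encode : Subdomains → Subset (FinSet.size Labels)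
    encode S = tabulate λ i → let (x , d) = FinSet.element Labels i in S x d

    decode-encode : ∀ S x d → decode (encode S) x d ≡ S x d
    decode-encode S x d = trans (lookup∘tabulate _ (FinSet.index Labels (x , d)))
                                (cong (λ (y , e) → S y e) (FinSet.element-index Labels (x , d)))

    arcConsistent? : ∀ S → Dec (ArcConsistent S)
    arcConsistent? S = FinSet.all? Con λ c → FinSet.all? (Dom (lhs c)) λ d → S (lhs c) d ≟ᵇ _

    ArcConsistent-cong : ∀ {S S′} → (∀ x → S x ≗ S′ x) → ArcConsistent S → ArcConsistent S′
    ArcConsistent-cong eq p c d = trans (sym (eq (lhs c) d)) (trans (p c d)
      (image-cong {Dom (rhs c)} {Dom (lhs c)} (λ _ → refl) (eq (rhs c)) d))

    InSome : (x : ∣ Var ∣) → ∣ Dom x ∣ → Set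
    InSome x d = ∃ λ V → ArcConsistent (decode V) × T (decode V x d)

    inSome? : ∀ x d → Dec (InSome x d)
    inSome? x d = anySubset? λ V → arcConsistent? (decode V) ×-dec T? (decode V x d)

    image-fun : ∀ c {S S′ : ∣ Dom (rhs c) ∣ → Bool} → (∀ e → T (S e) → T (S′ e)) →
                ∀ d → T (image {Dom (rhs c)} {Dom (lhs c)} (fun c) S d) →
                T (image {Dom (rhs c)} {Dom (lhs c)} (fun c) S′ d)
    image-fun c = image-mono {Dom (rhs c)} {Dom (lhs c)} {fun c} {fun c} (λ _ → refl)

  -- The union of all arc consistent families; by arcDom-consistent and
  -- arcDom-largest it is the largest one.
  abstract

    arcDom : Subdomains
    arcDom x d = isYes (inSome? x d)

    arcDom-largest : ∀ {S} → ArcConsistent S → ∀ x d → T (S x d) → T (arcDom x d)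
    arcDom-largest {S} p x d s = fromWitness {a? = inSome? x d}
      ( encode S
      , ArcConsistent-cong (λ y e → sym (decode-encode S y e)) p
      , subst T (sym (decode-encode S x d)) s )

    arcDom⁻ : ∀ x d → T (arcDom x d) → InSome x d
    arcDom⁻ x d = toWitness {a? = inSome? x d}

  arcDom-consistent : ArcConsistent arcDom
  arcDom-consistent c d = T-ext (λ p → to (arcDom⁻ (lhs c) d p))
    (λ p → from (∈-image⁻ {Dom (rhs c)} {Dom (lhs c)} {fun c} {arcDom (rhs c)} d p))
    where
    to : InSome (lhs c) d → T (image {Dom (rhs c)} {Dom (lhs c)} (fun c) (arcDom (rhs c)) d)
    to (V , q , s) = image-fun c (arcDom-largest {decode V} q (rhs c)) d (subst T (q c d) s)

    fun-closed : ∀ e → InSome (rhs c) e → T (arcDom (lhs c) (fun c e))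
    fun-closed e (V , q , t) = arcDom-largest {decode V} q (lhs c) (fun c e) (subst T (sym (q c (fun c e)))
      (∈-image⁺ {Dom (rhs c)} {Dom (lhs c)} {fun c} {decode V (rhs c)} e t))

    from : (∃ λ e → T (arcDom (rhs c) e) × fun c e ≡ d) → T (arcDom (lhs c) d)
    from (e , s , eq) = subst (T ∘ arcDom (lhs c)) eq (fun-closed e (arcDom⁻ (rhs c) e s))

  arc : LC
  arc = record
    { Var = Var
    ; Dom = λ x → sub (Dom x) (arcDom x)
    ; Con = Con
    ; lhs = lhs
    ; rhs = rhs
    ; fun = λ c (d , p) → fun c d ,
        subst T (sym (arcDom-consistent c (fun c d))) (∈-image⁺ {Dom (rhs c)} {Dom (lhs c)} {fun c} {arcDom (rhs c)} d p)
    }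

module _ {c ℓ} (R : Minion c ℓ) where
  open Minion R

  Dummy : ∀ {D} → ∣ D ∣ → Elem D → Set (lsuc 0ℓ ⊔ c ⊔ ℓ)
  Dummy {D} d r = Σ[ D″ ∈ FinSet ] Σ[ α ∈ (∣ D″ ∣ → ∣ D ∣) ] Σ[ r″ ∈ Elem D″ ]
                  (∀ x → α x ≢ d) × r ≈ map {D″} {D} α r″

  FromEmpty : ∀ {D} → Elem D → Set (c ⊔ ℓ)
  FromEmpty {D} r = Σ[ r″ ∈ Elem 𝟘 ] r ≈ map {𝟘} {D} ⊥-elim r″

  -- `fromEmpty` makes ωR closed under the maps α.  It says nothing if D′ is
  -- nonempty.  If D′ is empty, the image of (D′ , r) in a one-element set has
  -- a dummy if and only if it comes from R^(∅), and FromEmpty⇐ below shows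
  -- that r then comes from R^(∅) as well.  So `fromEmpty` follows from
  -- `dummies` whenever the pairs satisfying `dummies` form a minion.
  -- For Pol(A,B) they need not: if some relations of A are empty, a binary
  -- constant polymorphism has two dummies, while the unary one may have none.
  record IsSupport {D} (D′ : ∣ D ∣ → Bool) (r : Elem D) : Set (lsuc 0ℓ ⊔ c ⊔ ℓ) where
    field
      dummies   : ∀ d → ¬ T (D′ d) → Dummy d r
      fromEmpty : (∀ d → ¬ T (D′ d)) → FromEmpty r

  Dummy-cong : ∀ {D d} {r s : Elem D} → r ≈ s → Dummy d r → Dummy d s
  Dummy-cong r≈s (D″ , α , r″ , α≢ , eq) = D″ , α , r″ , α≢ , ≈.trans (≈.sym r≈s) eq

  -- If d₀ ∈ D′ and r has no essential element outside D′, then moving all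
  -- elements outside D′ to d₀ does not change r.
  module Retract {D} (D′ : ∣ D ∣ → Bool) (r : Elem D)
                 (dummies : ∀ d → ¬ T (D′ d) → Dummy d r)
                 (d₀ : ∣ D ∣) (d₀∈D′ : T (D′ d₀)) where
    open FinSet D using (_≟_; elements; ∈-elements)

    moveBy : ∀ {a d} → Dec (T (D′ a)) → Dec (d ≡ a) → ∣ D ∣
    moveBy         (no _)  (yes _) = d₀
    moveBy {d = d} (no _)  (no _)  = d
    moveBy {d = d} (yes _) _       = d

    move : ∣ D ∣ → ∣ D ∣ → ∣ D ∣
    move a d = moveBy (T? (D′ a)) (d ≟ a)

    move-fix : ∀ a → map {D} {D} (move a) r ≈ r
    move-fix a = fix (T? (D′ a))
      where
      fix : (a∈? : Dec (T (D′ a))) → map {D} {D} (λ d → moveBy a∈? (d ≟ a)) r ≈ r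
      fix (yes _) = map-id r
      fix (no a∉) with dummies a a∉
      ... | D″ , α , r″ , α≢a , eq = ≈.trans (map-cong (λ _ → refl) eq)
            (≈.trans (≈.sym (map-∘ _ α r″)) (≈.trans (map-cong fixed ≈.refl) (≈.sym eq)))
        where
        fixed : ∀ x → moveBy (no a∉) (α x ≟ a) ≡ α x
        fixed x with α x ≟ a
        ... | yes p = contradiction p (α≢a x)
        ... | no  _ = refl

    move-∈ : ∀ a d → T (D′ d) → T (D′ (move a d))
    move-∈ a d p with T? (D′ a) | d ≟ a
    ... | no  _ | yes _ = d₀∈D′
    ... | no  _ | no  _ = p
    ... | yes _ | _     = p

    move-self : ∀ a → T (D′ (move a a))
    move-self a with T? (D′ a) | a ≟ a
    ... | no  _ | yes _ = d₀∈D′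
    ... | no  _ | no ¬p = contradiction refl ¬p
    ... | yes p | _     = p

    move-≢ : ∀ a d → d ≢ a → move a d ≡ d
    move-≢ a d d≢a with T? (D′ a) | d ≟ a
    ... | no  _ | yes p = contradiction p d≢a
    ... | no  _ | no  _ = refl
    ... | yes _ | _     = refl

    moves : List ∣ D ∣ → ∣ D ∣ → ∣ D ∣
    moves []       = id
    moves (a ∷ as) = moves as ∘ move a

    moves-fix : ∀ as → map {D} {D} (moves as) r ≈ r
    moves-fix []       = map-id r
    moves-fix (a ∷ as) = ≈.trans (map-∘ (moves as) (move a) r)
      (≈.trans (map-cong (λ _ → refl) (move-fix a)) (moves-fix as))

    moves-∈ : ∀ as d → T (D′ d) → T (D′ (moves as d))
    moves-∈ []       d p = p
    moves-∈ (a ∷ as) d p = moves-∈ as (move a d) (move-∈ a d p)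

    moves-hit : ∀ as d → d ∈ as → T (D′ (moves as d))
    moves-hit (a ∷ as) d (here refl) = moves-∈ as (move a a) (move-self a)
    moves-hit (a ∷ as) d (there i)   = hit (d ≟ a)
      where
      hit : Dec (d ≡ a) → T (D′ (moves as (move a d)))
      hit (yes refl) = moves-∈ as (move a a) (move-self a)
      hit (no d≢a)   = subst (T ∘ D′ ∘ moves as) (sym (move-≢ a d d≢a)) (moves-hit as d i)

    retract : ∣ D ∣ → ∣ D ∣
    retract = moves elements

    retract-∈ : ∀ d → T (D′ (retract d))
    retract-∈ d = moves-hit elements d (∈-elements d)

    retract-fix : map {D} {D} retract r ≈ r
    retract-fix = moves-fix elements

  FromEmpty⇐ : ∀ {D} (r : Elem D) → ∣ D ∣ → (∀ d → Dummy d r) →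
               Dummy {𝟙} tt (map {D} {𝟙} (const tt) r) → FromEmpty r
  FromEmpty⇐ {D} r d₀ dummies (D″ , α , s , α≢ , eq) =
      map {D″} {𝟘} (λ x → α≢ x refl) s
    , ≈.trans (≈.sym retract-fix)
     (≈.trans (map-cong retract-const ≈.refl)
     (≈.trans (map-∘ {E = 𝟙} (const d₀) (const tt) r)
     (≈.trans (map-cong (λ _ → refl) eq)
     (≈.trans (≈.sym (map-∘ (const d₀) α s))
     (≈.trans (map-cong (λ x → ⊥-elim (α≢ x refl)) ≈.refl)
     (map-∘ {E = 𝟘} ⊥-elim (λ x → α≢ x refl) s))))))
    where
    open Retract {D} (λ d → isYes (FinSet._≟_ D d d₀)) r (λ d _ → dummies d) d₀ (fromWitness refl)
    retract-const : ∀ d → retract d ≡ d₀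
    retract-const d = toWitness (retract-∈ d)

  IsSupport-image : ∀ {D E} (α : ∣ D ∣ → ∣ E ∣) {D′} {r : Elem D} → IsSupport D′ r →
                    IsSupport (image {D} {E} α D′) (map {D} {E} α r)
  IsSupport-image {D} {E} α {D′} {r} supp = record
    { dummies   = λ e e∉ → dummies′ e e∉ (FinSet.any? D (λ d → T? (D′ d)))
    ; fromEmpty = λ empty → fromEmpty′ λ d p → empty (α d) (∈-image⁺ {D} {E} d p)
    }
    where
    open IsSupport supp
    fromEmpty′ : (∀ d → ¬ T (D′ d)) → FromEmpty (map {D} {E} α r)
    fromEmpty′ empty = let (s , eq) = fromEmpty empty in
      s , ≈.trans (map-cong (λ _ → refl) eq)
         (≈.trans (≈.sym (map-∘ α ⊥-elim s)) (map-cong (λ ()) ≈.refl))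

    dummies′ : ∀ e → ¬ T (image {D} {E} α D′ e) → Dec (∃ λ d → T (D′ d)) →
               Dummy e (map {D} {E} α r)
    dummies′ e e∉ (yes (d₀ , d₀∈D′)) =
        D , α ∘ retract , r
      , (λ { x refl → e∉ (∈-image⁺ {D} {E} (retract x) (retract-∈ x)) })
      , ≈.sym (≈.trans (map-∘ α retract r) (map-cong (λ _ → refl) retract-fix))
      where open Retract {D} D′ r dummies d₀ d₀∈D′
    dummies′ e e∉ (no ¬p) = let (s , eq) = fromEmpty′ (λ d p → ¬p (d , p)) in
      𝟘 , ⊥-elim , s , (λ ()) , eq

  record ωElem (D : FinSet) : Set (lsuc 0ℓ ⊔ c ⊔ ℓ) where
    constructor _,_by_
    field
      subset  : ∣ D ∣ → Bool
      elem    : Elem D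
      support : IsSupport subset elem

  open ωElem

  ω : Minion (lsuc 0ℓ ⊔ c ⊔ ℓ) ℓ
  ω = record
    { obj = λ D → record
        { Carrier = ωElem D
        ; _≈_     = λ p q → subset p ≗ subset q × elem p ≈ elem q
        ; isEquivalence = record
            { refl  = (λ _ → refl) , ≈.refl
            ; sym   = λ (S , e) → (λ d → sym (S d)) , ≈.sym e
            ; trans = λ (S , e) (S′ , e′) → (λ d → trans (S d) (S′ d)) , ≈.trans e e′
            }
        }
    ; map = λ {D} {E} α (D′ , r by s) →
        image {D} {E} α D′ , map {D} {E} α r by IsSupport-image α s
    ; map-cong = λ {D} {E} α≗β (S , e) → image-cong {D} {E} α≗β S , map-cong α≗β e
    ; map-id   = λ {D} (D′ , r by _) → image-id {D} D′ , map-id r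
    ; map-∘    = λ {D} {E} {F} β α (D′ , r by _) → image-∘ {D} {E} {F} β α D′ , map-∘ β α r
    }

-- LevelMinion k R is the (k+1)-st level, built on tuples r of length k+1 and w of
-- length k.
module LevelMinion {c ℓ} (k : ℕ) (R : Minion c ℓ) where
  open Minion R

  record LevelAt (C : FinSet) (ℰ : LC) : Set (c ⊔ ℓ) where
    open LC ℰ renaming (Var to Y)
    field
      discrete   : Discrete ℰ
      r          : Assignment (pow (suc k) ℰ) R
      r-solution : IsSolution (pow (suc k) ℰ) R r
      w          : (ȳ : Vec ∣ Y ∣ k) → Elem (C ×ᶠ Π Dom ȳ)
      w-origin   : Σ[ z ∈ ∣ Y ∣ ] Σ[ β ∈ (∣ Dom z ∣ → ∣ C ∣) ]
                   ∀ ȳ → w ȳ ≈ map {Dom z ×ᶠ Π Dom ȳ} {C ×ᶠ Π Dom ȳ} (map₁ β) (r (z ∷ ȳ))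

  open LevelAt

  Elemˡ : FinSet → Set (lsuc 0ℓ ⊔ c ⊔ ℓ)
  Elemˡ C = Σ[ ℰ ∈ LC ] LevelAt C ℰ

  -- Elements are equal if they agree as triples: same ℰ, equal r, equal w.
  data _≈ˡ_ {C : FinSet} : Elemˡ C → Elemˡ C → Set (lsuc 0ℓ ⊔ c ⊔ ℓ) where
    triple : ∀ {ℰ} {p q : LevelAt C ℰ} →
             (∀ x̄ → r p x̄ ≈ r q x̄) → (∀ ȳ → w p ȳ ≈ w q ȳ) → (ℰ , p) ≈ˡ (ℰ , q)

  mapAt : ∀ {C C′} → (∣ C ∣ → ∣ C′ ∣) → ∀ {ℰ} → LevelAt C ℰ → LevelAt C′ ℰ
  mapAt {C} {C′} α {ℰ} p = record
    { discrete   = discrete p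
    ; r          = r p
    ; r-solution = r-solution p
    ; w          = λ ȳ → map {C ×ᶠ Π Dom ȳ} {C′ ×ᶠ Π Dom ȳ} (map₁ α) (w p ȳ)
    ; w-origin   = let (z , β , eq) = w-origin p in
        z , α ∘ β , λ ȳ → ≈.trans (map-cong (λ _ → refl) (eq ȳ)) (≈.sym (map-∘ (map₁ α) (map₁ β) _))
    }
    where open LC ℰ

  level : Minion (lsuc 0ℓ ⊔ c ⊔ ℓ) (lsuc 0ℓ ⊔ c ⊔ ℓ)
  level = record
    { obj = λ C → record
        { Carrier = Elemˡ C
        ; _≈_     = _≈ˡ_
        ; isEquivalence = record
            { refl  = triple (λ _ → ≈.refl) (λ _ → ≈.refl)
            ; sym   = λ { (triple e f) → triple (λ x̄ → ≈.sym (e x̄)) (λ ȳ → ≈.sym (f ȳ)) }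
            ; trans = λ { (triple e f) (triple e′ f′) →
                triple (λ x̄ → ≈.trans (e x̄) (e′ x̄)) (λ ȳ → ≈.trans (f ȳ) (f′ ȳ)) }
            }
        }
    ; map      = λ α (ℰ , p) → ℰ , mapAt α p
    ; map-cong = λ { α≗β (triple e f) → triple e
        (λ ȳ → map-cong (λ (c , d) → cong (_, d) (α≗β c)) (f ȳ)) }
    ; map-id   = λ (ℰ , p) → triple (λ _ → ≈.refl) (λ ȳ → map-id (w p ȳ))
    ; map-∘    = λ β α (ℰ , p) → triple (λ _ → ≈.refl) (λ ȳ → map-∘ (map₁ β) (map₁ α) (w p ȳ))
    }

-- The tuples w have length k − 1, hence k ≥ 1.
lvl : ∀ {c ℓ} (k : ℕ) → .{{NonZero k}} → Minion c ℓ → Minion (lsuc 0ℓ ⊔ c ⊔ ℓ) (lsuc 0ℓ ⊔ c ⊔ ℓ)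
lvl (suc k) R = LevelMinion.level k R

record Signature : Set₁ where
  field
    Symbol : FinSet
    ar     : ∣ Symbol ∣ → ℕ

record Structure (𝕊 : Signature) : Set₁ where
  open Signature 𝕊
  field
    Universe : FinSet
    rel      : ∀ R → Vec ∣ Universe ∣ (ar R) → Bool

record Hom {𝕊} (𝔸 𝔹 : Structure 𝕊) : Set where
  open Signature 𝕊
  private
    module A = Structure 𝔸
    module B = Structure 𝔹
  field
    fun       : ∣ A.Universe ∣ → ∣ B.Universe ∣
    preserves : ∀ R (t : Vec ∣ A.Universe ∣ (ar R)) → T (A.rel R t) → T (B.rel R (Vec.map fun t))

record Template (𝕊 : Signature) : Set₁ where
  field
    𝔸 𝔹 : Structure 𝕊
    hom : Hom 𝔸 𝔹

power : ∀ {𝕊} → Structure 𝕊 → FinSet → Structure 𝕊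
power 𝔸 D = record
  { Universe = D ⇒ᶠ Universe
  ; rel      = λ R as → isYes (FinSet.all? D λ d →
                 T? (rel R (Vec.map (λ a → apply {D} {Universe} a d) as)))
  }
  where open Structure 𝔸

power-hom : ∀ {𝕊} (𝔸 : Structure 𝕊) {D E} → (∣ D ∣ → ∣ E ∣) → Hom (power 𝔸 E) (power 𝔸 D)
power-hom {𝕊} 𝔸 {D} {E} α = record
  { fun       = precompose {D} {E} {Universe} α
  ; preserves = λ R as p → fromWitness λ d →
      subst (T ∘ rel R)
        (trans (Vecₚ.map-cong (λ a → sym (apply-table {D} {Universe} (apply {E} {Universe} a ∘ α) d)) as)
               (Vecₚ.map-∘ _ _ as))
        (toWitness p (α d))
  }
  where open Structure 𝔸

_∘ʰ_ : ∀ {𝕊} {𝔸 𝔹 ℂ : Structure 𝕊} → Hom 𝔹 ℂ → Hom 𝔸 𝔹 → Hom 𝔸 ℂ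
_∘ʰ_ {ℂ = ℂ} g f = record
  { fun       = Hom.fun g ∘ Hom.fun f
  ; preserves = λ R t p → subst (T ∘ Structure.rel ℂ R) (sym (Vecₚ.map-∘ _ _ t))
      (Hom.preserves g R _ (Hom.preserves f R t p))
  }

Pol : ∀ {𝕊} → Structure 𝕊 → Structure 𝕊 → Minion 0ℓ 0ℓ
Pol 𝔸 𝔹 = record
  { obj = λ D → record
      { Carrier = Hom (power 𝔸 D) 𝔹
      ; _≈_     = λ f g → Hom.fun f ≗ Hom.fun g
      ; isEquivalence = record
          { refl  = λ _ → refl
          ; sym   = λ e a → sym (e a)
          ; trans = λ e e′ a → trans (e a) (e′ a)
          }
      }
  ; map      = λ {D} {E} α f → f ∘ʰ power-hom 𝔸 {D} {E} α
  ; map-cong = λ {D} {E} {_} {_} {_} {g} α≗β e a → trans (e _)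
      (cong (Hom.fun g) (table-cong {D} {A} (λ d → cong (apply {E} {A} a) (α≗β d))))
  ; map-id   = λ {D} f a → cong (Hom.fun f) (table-apply {D} {A} a)
  ; map-∘    = λ {D} {E} {F} β α f a → cong (Hom.fun f)
      (table-cong {D} {A} (λ d → sym (apply-table {E} {A} (apply {F} {A} a ∘ β) (α d))))
  }
  where
  A : FinSet
  A = Structure.Universe 𝔸

polymorphisms : ∀ {𝕊} → Template 𝕊 → Minion 0ℓ 0ℓ
polymorphisms 𝒯 = Pol 𝔸 𝔹
  where open Template 𝒯

-- As for LC, the list of constraints is a family indexed by a finite set.
-- The variable set is part of the data; not every variable has to occur in
-- a constraint.
record Instance (𝕊 : Signature) : Set₁ where
  open Signature 𝕊
  field
    Var  : FinSet
    Con  : FinSet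
    symb : ∣ Con ∣ → ∣ Symbol ∣
    args : ∀ c → Vec ∣ Var ∣ (ar (symb c))

record Solution {𝕊} (ℐ : Instance 𝕊) (𝔹 : Structure 𝕊) : Set where
  open Instance ℐ
  open Structure 𝔹
  field
    val       : ∣ Var ∣ → ∣ Universe ∣
    satisfied : ∀ c → T (rel (symb c) (Vec.map val (args c)))

lc : ∀ {𝕊} → Structure 𝕊 → Instance 𝕊 → LC
lc {𝕊} 𝔸 ℐ = record
  { Var = Var ⊎ᶠ Con
  ; Dom = λ { (inj₁ _) → Universe
            ; (inj₂ c) → sub (Vecᶠ Universe (ar (symb c))) (rel (symb c)) }
  ; Con = Σᶠ Con (λ c → Finᶠ (ar (symb c)))
  ; lhs = λ (c , i) → inj₁ (lookup (args c) i)
  ; rhs = λ (c , _) → inj₂ c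
  ; fun = λ (_ , i) (t , _) → lookup t i
  }
  where
  open Signature 𝕊
  open Structure 𝔸
  open Instance ℐ

-- The condition a₁(d) … aₙ(d) ∈ R for all d ∈ D_x says that (a₁ , … , aₙ)
-- belongs to R in the power 𝔸^(D_x).
module Csp {𝕊} (𝔸 : Structure 𝕊) (𝒟 : LC) where
  open Signature 𝕊
  open Structure 𝔸
  open LC 𝒟

  Pairs : FinSet
  Pairs = Σᶠ Var (λ x → Dom x ⇒ᶠ Universe)

  Identifications : FinSet
  Identifications = Σᶠ Con (λ c → Dom (lhs c) ⇒ᶠ Universe)

  left right : ∣ Identifications ∣ → ∣ Pairs ∣
  left  (c , a) = lhs c , a
  right (c , a) = rhs c , precompose {Dom (rhs c)} {Dom (lhs c)} {Universe} (fun c) a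

  variables : Quotient Pairs (Generator {Pairs} left right)
  variables = generatedQuotient Pairs Identifications left right

  open Quotient variables public

  csp : Instance 𝕊
  csp = record
    { Var  = quotient
    ; Con  = Σᶠ Symbol λ R → Σᶠ Var λ x →
               sub (Vecᶠ (Dom x ⇒ᶠ Universe) (ar R)) (Structure.rel (power 𝔸 (Dom x)) R)
    ; symb = proj₁
    ; args = λ (_ , x , as , _) → Vec.map (λ a → [ x , a ]) as
    }

consistencyReduction : ∀ {𝕊 𝕊′} → ℕ → Structure 𝕊′ → Structure 𝕊 → Instance 𝕊′ → Instance 𝕊
consistencyReduction k 𝔸′ 𝔸 ℐ = Csp.csp 𝔸 (arc (pow k (lc 𝔸′ ℐ)))

ReducesVia : ∀ {𝕊′ 𝕊} → (Instance 𝕊′ → Instance 𝕊) → Template 𝕊′ → Template 𝕊 → Set₁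
ReducesVia {𝕊′} _♯ 𝒯′ 𝒯 = ∀ (ℐ : Instance 𝕊′) →
    (Solution ℐ 𝒯′.𝔸 → Solution (ℐ ♯) 𝒯.𝔸)
  × (Solution (ℐ ♯) 𝒯.𝔹 → Solution ℐ 𝒯′.𝔹)
  where
  module 𝒯′ = Template 𝒯′
  module 𝒯 = Template 𝒯

{-# OPTIONS --safe #-}

-- Solutions of csp_A(arc(pow_k D)) in B are solutions of arc(pow_k D) in M = Pol(A,B), and these
-- correspond to solutions of pow_k D in ωM: the support of an element is an arc consistent
-- family, and elements can be retracted onto it.  So the soundness of the reduction says: if
-- pow_k lc(I) is solvable in ωM, then I is solvable in B′.
--
-- A homomorphism ξ from the level turns a solution r of pow_k D into a solution of D, namely
-- x ↦ ξ(D without its constraints, r, r_x∗), because r_x∗ = α(r_y∗) for all constraints x = α(y).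
--
-- Conversely, fix ℰ and r.  There are finitely many elements (ℰ, r, w) of the level at A′, and they
-- form an instance I (the free structure generated by A′), whose solutions in B′ are the
-- homomorphisms from this part of the level to Pol(A′,B′).  pow_k lc(I) is solvable in ωM: its
-- variables are tuples of origins (z, β) of such w, and r can be pushed forward along the βs.
-- The result does not depend on the choice of the origins, as they can be exchanged one at a
-- time, after moving them to the first position by a permutation.
-- The solution of I is chosen as the first one in a fixed enumeration, and I is built from a
-- table of Booleans, so that ξ respects the equality of triples.
module Submission where

open import Defs
open import Data.Bool.Base using (Bool; T)
open import Data.Bool.Properties using (T?) renaming (_≟_ to _≟ᵇ_)
open import Data.Empty using (⊥-elim)
open import Data.Fin.Base using (Fin; zero; suc; punchIn; punchOut)
import Data.Fin.Properties as Fin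
open import Data.List.Base using ([]; _∷_)
open import Data.Nat.Base using (ℕ; zero; suc; NonZero)
open import Data.Product.Base using (Σ; ∃; Σ-syntax; _×_; _,_; proj₁; proj₂; map₁; map₂)
open import Data.Sum.Base using (inj₁; inj₂)
open import Data.Unit.Base using (⊤; tt)
import Data.Vec.Base as Vec
open Vec using (Vec; []; _∷_; lookup; tabulate)
import Data.Vec.Properties as Vecₚ
open import Function.Base using (id; _∘_)
open import Function.Bundles using (_⇔_; mk⇔)
open import Function.Construct.Symmetry using (↔-sym)
open import Level using (Level)
open import Relation.Binary.Bundles using (Setoid)
import Relation.Binary.Construct.Closure.Equivalence as EqC
open import Relation.Binary.PropositionalEquality
  using (_≡_; _≢_; _≗_; refl; sym; trans; cong; cong₂; dcong; subst; isEquivalence)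
import Relation.Binary.Reasoning.Setoid as SetoidReasoning
open import Relation.Binary.Structures using (IsEquivalence)
open import Relation.Nullary.Decidable
  using (Dec; yes; no; decidable-stable; ¬?; isYes; toWitness; fromWitness; map′; _×-dec_)
open import Relation.Nullary.Negation using (¬_; contradiction)

private
  variable
    c ℓ c′ ℓ′ : Level
    m n : ℕ

-- Solutions in a polymorphism minion and solutions of the csp instance.

Solvable : LC → Minion c ℓ → Set _
Solvable 𝒟 R = Σ (Assignment 𝒟 R) (IsSolution 𝒟 R)

module _ {𝕊} {𝔸 𝔹 : Structure 𝕊} {𝒟 : LC} where
  open Structure 𝔹 using (rel)
  open Csp 𝔸 𝒟

  -- A class takes the value of its representative. Other members give the same value, since the
  -- constraints of `𝒟` make `s` respect the generating identifications.
  solvable⇒csp : Solvable 𝒟 (Pol 𝔸 𝔹) → Solution (Csp.csp 𝔸 𝒟) 𝔹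
  solvable⇒csp (s , s-solution) = record
    { val       = value ∘ rep
    ; satisfied = λ (R , x , as , p) → subst (T ∘ rel R)
        (trans (Vecₚ.map-cong (λ a → sym (value-resp (complete ([rep] [ x , a ])))) as)
               (Vecₚ.map-∘ (value ∘ rep) (λ a → [ x , a ]) as))
        (Hom.preserves (s x) R as p)
    }
    where
    value : ∣ Pairs ∣ → ∣ Structure.Universe 𝔹 ∣
    value (x , a) = Hom.fun (s x) a

    value-resp : ∀ {u v} → EqC.EqClosure (Generator {Pairs} left right) u v → value u ≡ value v
    value-resp = EqC.gfold isEquivalence value λ { ((c , a) , refl , refl) → s-solution c a }

  csp⇒solvable : Solution (Csp.csp 𝔸 𝒟) 𝔹 → Solvable 𝒟 (Pol 𝔸 𝔹)
  csp⇒solvable s =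
      (λ x → record
        { fun       = λ a → val [ x , a ]
        ; preserves = λ R as p → subst (T ∘ rel R)
            (sym (Vecₚ.map-∘ val (λ a → [ x , a ]) as)) (satisfied (R , x , as , p))
        })
    , λ c a → cong val (sound (EqC.return ((c , a) , refl , refl)))
    where open Solution s

-- Solutions in `ω R` and solutions on the arc consistent subdomains.

module _ {R : Minion c ℓ} {𝒟 : LC} where
  open Minion R
  open LC 𝒟

  module _ {D : FinSet} (D′ : ∣ D ∣ → Bool) (r : Elem D) (dummies : ∀ d → ¬ T (D′ d) → Dummy R d r)
           (d₀ : ∣ D ∣) (d₀∈D′ : T (D′ d₀)) where
    open Retract R {D} D′ r dummies d₀ d₀∈D′

    move-idle : ∀ a d → T (D′ d) → move a d ≡ d
    move-idle a d d∈ with T? (D′ a) | FinSet._≟_ D d a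
    ... | yes _ | _        = refl
    ... | no _  | no _     = refl
    ... | no a∉ | yes refl = contradiction d∈ a∉

    moves-idle : ∀ as d → T (D′ d) → moves as d ≡ d
    moves-idle []       d d∈ = refl
    moves-idle (a ∷ as) d d∈ = trans (cong (moves as) (move-idle a d d∈)) (moves-idle as d d∈)

    retract-idle : ∀ d → T (D′ d) → retract d ≡ d
    retract-idle = moves-idle (FinSet.elements D)

  -- All maps from `𝟘` to a given domain agree, so the images of one element of arity `𝟘` satisfy
  -- every constraint.
  empty⇒solvable : ∀ (ℰ : LC) → Elem 𝟘 → Solvable ℰ R
  empty⇒solvable ℰ e =
      (λ x → map {𝟘} {LC.Dom ℰ x} ⊥-elim e)
    , λ c → ≈.trans (map-cong (λ ()) ≈.refl) (map-∘ (LC.fun ℰ c) ⊥-elim e)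

  -- Equality in `ω R` makes the subsets of a solution arc consistent, so they lie within `arcDom`,
  -- and labels outside `arcDom` are dummies. If all subdomains are inhabited, the elements are
  -- retracted onto them. If one is empty, `fromEmpty` provides an element of arity `𝟘`.
  solvable-ω⇒solvable-arc : Solvable 𝒟 (ω R) → Solvable (arc 𝒟) R
  solvable-ω⇒solvable-arc (s , s-solution) = by-cases (FinSet.any? Var λ x → ¬? (nonempty? x))
    where
    open ωElem

    nonempty? : ∀ x → Dec (∃ λ d → T (arcDom 𝒟 x d))
    nonempty? x = FinSet.any? (Dom x) λ d → T? (arcDom 𝒟 x d)

    subset⊆arcDom : ∀ x d → T (subset (s x) d) → T (arcDom 𝒟 x d)
    subset⊆arcDom = arcDom-largest 𝒟 (λ c → proj₁ (s-solution c))

    module Nonempty (nonempty : ∀ x → ∃ λ d → T (arcDom 𝒟 x d)) where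

      dummies : ∀ x d → ¬ T (arcDom 𝒟 x d) → Dummy R d (elem (s x))
      dummies x d d∉ = IsSupport.dummies (support (s x)) d (d∉ ∘ subset⊆arcDom x d)

      module ρ x = Retract R {Dom x} (arcDom 𝒟 x) (elem (s x)) (dummies x)
                     (proj₁ (nonempty x)) (proj₂ (nonempty x))

      ρ : ∀ x → ∣ Dom x ∣ → ∣ LC.Dom (arc 𝒟) x ∣
      ρ x d = ρ.retract x d , ρ.retract-∈ x d

      -- After the retraction at `rhs c`, the map `fun c` lands in `arcDom` at `lhs c`, where the
      -- other retraction is idle.
      commutes : ∀ c d → ρ (lhs c) (fun c (ρ.retract (rhs c) d)) ≡ LC.fun (arc 𝒟) c (ρ (rhs c) d)
      commutes c d = sub-≡ {Dom (lhs c)} {arcDom 𝒟 (lhs c)}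
        (retract-idle {Dom (lhs c)} (arcDom 𝒟 (lhs c)) (elem (s (lhs c))) (dummies (lhs c))
          (proj₁ (nonempty (lhs c))) (proj₂ (nonempty (lhs c))) _ (proj₂ (LC.fun (arc 𝒟) c (ρ (rhs c) d))))

      solvable : Solvable (arc 𝒟) R
      solvable = (λ x → map {Dom x} {LC.Dom (arc 𝒟) x} (ρ x) (elem (s x))) , λ c → begin
        map (ρ (lhs c)) (elem (s (lhs c)))
          ≈⟨ map-cong (λ _ → refl) (proj₂ (s-solution c)) ⟩
        map (ρ (lhs c)) (map {Dom (rhs c)} {Dom (lhs c)} (fun c) (elem (s (rhs c))))
          ≈⟨ map-∘ (ρ (lhs c)) (fun c) _ ⟨
        map (ρ (lhs c) ∘ fun c) (elem (s (rhs c)))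
          -- The retractions need not commute with `fun c` outside `arcDom`, so the element is first
          -- replaced by its retract.
          ≈⟨ map-cong (λ _ → refl) (ρ.retract-fix (rhs c)) ⟨
        map (ρ (lhs c) ∘ fun c) (map {Dom (rhs c)} {Dom (rhs c)} (ρ.retract (rhs c)) (elem (s (rhs c))))
          ≈⟨ map-∘ (ρ (lhs c) ∘ fun c) (ρ.retract (rhs c)) _ ⟨
        map (ρ (lhs c) ∘ fun c ∘ ρ.retract (rhs c)) (elem (s (rhs c)))
          ≈⟨ map-cong (commutes c) ≈.refl ⟩
        map (LC.fun (arc 𝒟) c ∘ ρ (rhs c)) (elem (s (rhs c)))
          ≈⟨ map-∘ (LC.fun (arc 𝒟) c) (ρ (rhs c)) _ ⟩
        map (LC.fun (arc 𝒟) c) (map (ρ (rhs c)) (elem (s (rhs c)))) ∎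
        where open module Reasoning {D} = SetoidReasoning (obj D)

    by-cases : Dec (∃ λ x → ¬ ∃ λ d → T (arcDom 𝒟 x d)) → Solvable (arc 𝒟) R
    by-cases (yes (x , empty)) = empty⇒solvable (arc 𝒟)
      (proj₁ (IsSupport.fromEmpty (support (s x)) λ d d∈ → empty (d , subset⊆arcDom x d d∈)))
    by-cases (no nonempty)     = Nonempty.solvable
      λ x → decidable-stable (nonempty? x) λ empty → nonempty (x , empty)

  -- The inclusion of the subdomain is itself the witness that the labels outside are dummies; it
  -- factors through `𝟘` if the subdomain is empty.
  solvable-arc⇒solvable-ω : Solvable (arc 𝒟) R → Solvable 𝒟 (ω R)
  solvable-arc⇒solvable-ω (s , s-solution) =
      (λ x → arcDom 𝒟 x , map {Dom′ x} {Dom x} proj₁ (s x) by record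
        { dummies   = λ d d∉ → Dom′ x , proj₁ , s x , (λ { (_ , d∈) refl → d∉ d∈ }) , ≈.refl
        ; fromEmpty = λ empty → map {Dom′ x} {𝟘} (λ (d , d∈) → empty d d∈) (s x)
            , ≈.trans (map-cong (λ (d , d∈) → contradiction d∈ (empty d)) ≈.refl)
                      (map-∘ {E = 𝟘} ⊥-elim (λ (d , d∈) → empty d d∈) (s x))
        })
    , λ c → arcDom-consistent 𝒟 c
    , ≈.trans (map-cong (λ _ → refl) (s-solution c))
     (≈.trans (≈.sym (map-∘ proj₁ (LC.fun (arc 𝒟) c) (s (rhs c)))) (map-∘ (fun c) proj₁ (s (rhs c))))
    where
    Dom′ : ∣ Var ∣ → FinSet
    Dom′ = LC.Dom (arc 𝒟)

-- Transport between equal index tuples, and reindexings with a left inverse.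

same-fibre : ∀ {A : Set} {B : A → Set} {x} {y z : B x} → _≡_ {A = Σ A B} (x , y) (x , z) → y ≡ z
same-fibre refl = refl

module _ (R : Minion c ℓ) where
  open Minion R

  map-cancel : ∀ {D E} (f : ∣ D ∣ → ∣ E ∣) (g : ∣ E ∣ → ∣ D ∣) {r s : Elem D} → g ∘ f ≗ id →
               map {D} {E} f r ≈ map {D} {E} f s → r ≈ s
  map-cancel {D} {E} f g {r} {s} g∘f≗id eq =
    ≈.trans (recover r) (≈.trans (map-cong (λ _ → refl) eq) (≈.sym (recover s)))
    where
    recover : ∀ r → r ≈ map {E} {D} g (map {D} {E} f r)
    recover r = ≈.trans (≈.sym (map-id r))
      (≈.trans (map-cong (λ d → sym (g∘f≗id d)) ≈.refl) (map-∘ g f r))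

  -- Here `f` is a transport between equal index vectors. The equation between pairs says so without
  -- prescribing its form, so a map computed by recursion, such as `funs`, qualifies.
  assignment-subst : ∀ {Y : Set} {Dom : Y → FinSet} (r : (ȳ : Vec Y n) → Elem (Π Dom ȳ)) {ȳ z̄} →
    ȳ ≡ z̄ → (f : ∣ Π Dom ȳ ∣ → ∣ Π Dom z̄ ∣) →
    (∀ d → _≡_ {A = Σ (Vec Y n) (∣_∣ ∘ Π Dom)} (ȳ , d) (z̄ , f d)) →
    r z̄ ≈ map {Π Dom ȳ} {Π Dom z̄} f (r ȳ)
  assignment-subst r {ȳ} refl f eq =
    ≈.trans (≈.sym (map-id (r ȳ))) (map-cong (λ d → same-fibre (eq d)) ≈.refl)

module _ {X : Set} {D : X → FinSet} where

  assemble : (xs : Vec X n) → (∀ i → ∣ D (lookup xs i) ∣) → ∣ Π D xs ∣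
  assemble []       ds = tt
  assemble (x ∷ xs) ds = ds zero , assemble xs (ds ∘ suc)

  assemble-component : (xs : Vec X n) {d : ∣ Π D xs ∣} {ds : ∀ i → ∣ D (lookup xs i) ∣} →
                       (∀ i → ds i ≡ component {D = D} xs d i) → assemble xs ds ≡ d
  assemble-component []       eq = refl
  assemble-component (x ∷ xs) eq = cong₂ _,_ (eq zero) (assemble-component xs (eq ∘ suc))

  selected : (σ : Vec (Fin n) m) (xs : Vec X n) → ∣ Π D (Vec.map (lookup xs) σ) ∣ →
             ∀ l → ∣ D (lookup xs (lookup σ l)) ∣
  selected (i ∷ σ) xs (d , ds) zero    = d
  selected (i ∷ σ) xs (d , ds) (suc l) = selected σ xs ds l

  selected-reindex : ∀ (σ : Vec (Fin n) m) xs d l →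
                     selected σ xs (reindex σ xs d) l ≡ component {D = D} xs d (lookup σ l)
  selected-reindex (i ∷ σ) xs d zero    = refl
  selected-reindex (i ∷ σ) xs d (suc l) = selected-reindex σ xs d l

  module _ (σ : Vec (Fin n) m) (τ : ∀ i → ∃ λ l → lookup σ l ≡ i) (xs : Vec X n) where

    -- By `τ` every coordinate occurs in `σ`, so reindexing loses no component.
    unreindex : ∣ Π D (Vec.map (lookup xs) σ) ∣ → ∣ Π D xs ∣
    unreindex d = assemble xs λ i →
      subst (λ j → ∣ D (lookup xs j) ∣) (proj₂ (τ i)) (selected σ xs d (proj₁ (τ i)))

    unreindex-reindex : unreindex ∘ reindex {D = D} σ xs ≗ id
    unreindex-reindex d = assemble-component xs λ i →
      trans (cong (subst (λ j → ∣ D (lookup xs j) ∣) (proj₂ (τ i))) (selected-reindex σ xs d (proj₁ (τ i))))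
            (dcong (component {D = D} xs d) (proj₂ (τ i)))

-- Origins are compared at the first coordinate only; this permutation brings coordinate `i` there.
toFront : Fin (suc n) → Vec (Fin (suc n)) (suc n)
toFront i = i ∷ tabulate (punchIn i)

toFront-surjective : (i j : Fin (suc n)) → ∃ λ l → lookup (toFront i) l ≡ j
toFront-surjective i j with i Fin.≟ j
... | yes eq = zero , eq
... | no i≢j = suc (punchOut i≢j) ,
  trans (Vecₚ.lookup∘tabulate (punchIn i) (punchOut i≢j)) (Fin.punchIn-punchOut i≢j)

-- The pairs (z , β) from which the third component of an element of the level arises.
record Origin (ℰ : LC) (D : FinSet) : Set where
  constructor _,_
  field
    variableOf : ∣ LC.Var ℰ ∣
    function   : ∣ LC.Dom ℰ variableOf ∣ → ∣ D ∣

infixr 9 _⊚_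

_⊚_ : ∀ {ℰ D E} → (∣ D ∣ → ∣ E ∣) → Origin ℰ D → Origin ℰ E
α ⊚ (y , γ) = y , α ∘ γ

-- Pushing a solution of the power forward along a choice of origins.

module Pushforward {R : Minion c ℓ} {k : ℕ} {ℰ : LC}
                   (r : Assignment (pow (suc k) ℰ) R) (r-solution : IsSolution (pow (suc k) ℰ) R r) where
  open Minion R
  open LC ℰ using (Dom) renaming (Var to Y)

  infix 4 _∼_

  -- Related origins are those that give the same third component `w` over the fixed `ℰ` and `r`.
  record _∼_ {D : FinSet} (g h : Origin ℰ D) : Set ℓ where
    constructor at-all
    field
      at : let (y , γ) = g; (z , δ) = h in ∀ (ȳ : Vec ∣ Y ∣ k) →
        map {Dom y ×ᶠ Π Dom ȳ} {D ×ᶠ Π Dom ȳ} (map₁ γ) (r (y ∷ ȳ)) ≈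
        map {Dom z ×ᶠ Π Dom ȳ} {D ×ᶠ Π Dom ȳ} (map₁ δ) (r (z ∷ ȳ))

  open _∼_ public

  ∼-isEquivalence : ∀ {D} → IsEquivalence (_∼_ {D})
  ∼-isEquivalence = record
    { refl  = at-all λ _ → ≈.refl
    ; sym   = λ e → at-all λ ȳ → ≈.sym (at e ȳ)
    ; trans = λ e e′ → at-all λ ȳ → ≈.trans (at e ȳ) (at e′ ȳ)
    }

  module ∼ {D} = IsEquivalence (∼-isEquivalence {D})

  ∼-pointwise : ∀ {D y} {γ δ : ∣ Dom y ∣ → ∣ D ∣} → γ ≗ δ → _∼_ {D} (y , γ) (y , δ)
  ∼-pointwise {D} {y} γ≗δ = at-all λ ȳ →
    map-cong {Dom y ×ᶠ Π Dom ȳ} {D ×ᶠ Π Dom ȳ} (λ (d , ds) → cong (_, ds) (γ≗δ d)) ≈.refl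

  ⊚-∼ : ∀ {D E} (α : ∣ D ∣ → ∣ E ∣) {g h : Origin ℰ D} → g ∼ h → _∼_ {E} (α ⊚ g) (α ⊚ h)
  ⊚-∼ {D} {E} α {g} {h} g∼h = at-all λ ȳ →
    ≈.trans (split g ȳ)
    (≈.trans (map-cong {D ×ᶠ Π Dom ȳ} {E ×ᶠ Π Dom ȳ} (λ _ → refl) (at g∼h ȳ)) (≈.sym (split h ȳ)))
    where
    split : ((y , γ) : Origin ℰ D) (ȳ : Vec ∣ Y ∣ k) →
      map {Dom y ×ᶠ Π Dom ȳ} {E ×ᶠ Π Dom ȳ} (map₁ (α ∘ γ)) (r (y ∷ ȳ)) ≈
      map {D ×ᶠ Π Dom ȳ} {E ×ᶠ Π Dom ȳ} (map₁ α)
        (map {Dom y ×ᶠ Π Dom ȳ} {D ×ᶠ Π Dom ȳ} (map₁ γ) (r (y ∷ ȳ)))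
    split (y , γ) ȳ = map-∘ {Dom y ×ᶠ Π Dom ȳ} {D ×ᶠ Π Dom ȳ} {E ×ᶠ Π Dom ȳ} (map₁ α) (map₁ γ) (r (y ∷ ȳ))

  module _ {X : Set} {F : X → FinSet} where

    Maps : Vec ∣ Y ∣ n → Vec X n → Set
    Maps []       []       = ⊤
    Maps (y ∷ ys) (x ∷ xs) = (∣ Dom y ∣ → ∣ F x ∣) × Maps ys xs

    -- One origin per coordinate, with their variables collected in a vector at which `r` can be
    -- evaluated.
    Tuple : Vec X n → Set
    Tuple {n} xs = Σ[ ys ∈ Vec ∣ Y ∣ n ] Maps ys xs

    cons : ∀ {x} {xs : Vec X n} → Origin ℰ (F x) → Tuple xs → Tuple (x ∷ xs)
    cons (y , γ) (ys , γs) = y ∷ ys , γ , γs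

    applyAll : ∀ {ys : Vec ∣ Y ∣ n} {xs} → Maps ys xs → ∣ Π Dom ys ∣ → ∣ Π F xs ∣
    applyAll {ys = []}    {[]}     γs       ds       = tt
    applyAll {ys = _ ∷ _} {_ ∷ _} (γ , γs) (d , ds) = γ d , applyAll γs ds

    mapAt : ∀ {ys : Vec ∣ Y ∣ n} {xs} → Maps ys xs → ∀ i → ∣ Dom (lookup ys i) ∣ → ∣ F (lookup xs i) ∣
    mapAt {ys = _ ∷ _} {_ ∷ _} (γ , γs) zero    = γ
    mapAt {ys = _ ∷ _} {_ ∷ _} (γ , γs) (suc i) = mapAt γs i

    component-applyAll : ∀ {ys : Vec ∣ Y ∣ n} {xs} (γs : Maps ys xs) d i →
      component {D = F} xs (applyAll γs d) i ≡ mapAt γs i (component {D = Dom} ys d i)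
    component-applyAll {ys = _ ∷ _} {_ ∷ _} (γ , γs) (d , ds) zero    = refl
    component-applyAll {ys = _ ∷ _} {_ ∷ _} (γ , γs) (d , ds) (suc i) = component-applyAll γs ds i

    entry : ∀ {xs : Vec X n} → Tuple xs → ∀ i → Origin ℰ (F (lookup xs i))
    entry (ys , γs) i = lookup ys i , mapAt γs i

    selectMaps : ∀ {ys : Vec ∣ Y ∣ n} {xs} (σ : Vec (Fin n) m) → Maps ys xs →
                 Maps (Vec.map (lookup ys) σ) (Vec.map (lookup xs) σ)
    selectMaps []      γs = tt
    selectMaps (i ∷ σ) γs = mapAt γs i , selectMaps σ γs

    select : ∀ {xs : Vec X n} (σ : Vec (Fin n) m) → Tuple xs → Tuple (Vec.map (lookup xs) σ)
    select σ (ys , γs) = Vec.map (lookup ys) σ , selectMaps σ γs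

    applyAll-reindex : ∀ {ys : Vec ∣ Y ∣ n} {xs} (σ : Vec (Fin n) m) (γs : Maps ys xs) d →
      applyAll (selectMaps σ γs) (reindex {D = Dom} σ ys d) ≡ reindex {D = F} σ xs (applyAll γs d)
    applyAll-reindex []      γs d = refl
    applyAll-reindex (i ∷ σ) γs d = cong₂ _,_ (sym (component-applyAll γs d i)) (applyAll-reindex σ γs d)

    replace : ∀ {xs : Vec X n} → Tuple xs → ∀ i → Origin ℰ (F (lookup xs i)) → Tuple xs
    replace {xs = _ ∷ _} (_ ∷ ys , _ , γs) zero    g = cons g (ys , γs)
    replace {xs = _ ∷ _} (y ∷ ys , γ , γs) (suc i) g = cons (y , γ) (replace (ys , γs) i g)

    entry-replace-≡ : ∀ {xs : Vec X n} (t : Tuple xs) i g → entry (replace t i g) i ≡ g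
    entry-replace-≡ {xs = _ ∷ _} (_ ∷ ys , _ , γs) zero    g = refl
    entry-replace-≡ {xs = _ ∷ _} (_ ∷ ys , _ , γs) (suc i) g = entry-replace-≡ (ys , γs) i g

    entry-replace-≢ : ∀ {xs : Vec X n} (t : Tuple xs) {i j} g → j ≢ i → entry (replace t i g) j ≡ entry t j
    entry-replace-≢ {xs = _ ∷ _} (_ ∷ ys , _ , γs) {zero}  {zero}  g j≢i = contradiction refl j≢i
    entry-replace-≢ {xs = _ ∷ _} (_ ∷ ys , _ , γs) {zero}  {suc j} g j≢i = refl
    entry-replace-≢ {xs = _ ∷ _} (_ ∷ ys , _ , γs) {suc i} {zero}  g j≢i = refl
    entry-replace-≢ {xs = _ ∷ _} (_ ∷ ys , _ , γs) {suc i} {suc j} g j≢i =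
      entry-replace-≢ (ys , γs) g (j≢i ∘ cong suc)

    select-replace : ∀ {xs : Vec X n} (σ : Vec (Fin n) m) (t : Tuple xs) {i} g →
      (∀ l → lookup σ l ≢ i) → select σ (replace t i g) ≡ select σ t
    select-replace []      t g i∉σ = refl
    select-replace (j ∷ σ) t g i∉σ =
      cong₂ cons (entry-replace-≢ t g (i∉σ zero)) (select-replace σ t g (i∉σ ∘ suc))

    eval : {xs : Vec X (suc k)} → Tuple xs → Elem (Π F xs)
    eval {xs} (ys , γs) = map {Π Dom ys} {Π F xs} (applyAll γs) (r ys)

    -- This is constraint (2) of the power at the variables of the origins, as applying the maps
    -- commutes with reindexing.
    eval-select : ∀ {xs} (σ : Vec (Fin (suc k)) (suc k)) (t : Tuple xs) →
      eval (select σ t) ≈ map {Π F xs} {Π F (Vec.map (lookup xs) σ)} (reindex σ xs) (eval t)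
    eval-select {xs} σ (ys , γs) = begin
      map (applyAll (selectMaps σ γs)) (r (Vec.map (lookup ys) σ))
        ≈⟨ map-cong (λ _ → refl) (r-solution (inj₂ (ys , σ))) ⟩
      map (applyAll (selectMaps σ γs)) (map {Π Dom ys} {Π Dom (Vec.map (lookup ys) σ)} (reindex σ ys) (r ys))
        ≈⟨ map-∘ (applyAll (selectMaps σ γs)) (reindex σ ys) (r ys) ⟨
      map (applyAll (selectMaps σ γs) ∘ reindex σ ys) (r ys)
        ≈⟨ map-cong (applyAll-reindex σ γs) ≈.refl ⟩
      map (reindex σ xs ∘ applyAll γs) (r ys)
        ≈⟨ map-∘ (reindex σ xs) (applyAll γs) (r ys) ⟩
      map (reindex σ xs) (map {Π Dom ys} {Π F xs} (applyAll γs) (r ys)) ∎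
      where open SetoidReasoning (obj (Π F (Vec.map (lookup xs) σ)))

    -- The product of the maps factors through the map of the first origin alone, where `g ∼ g′`
    -- applies.
    eval-cons : ∀ {x xs} {g g′ : Origin ℰ (F x)} (t : Tuple xs) → g ∼ g′ → eval (cons g t) ≈ eval (cons g′ t)
    eval-cons {x} {xs} {g} {g′} (ys , γs) g∼g′ =
      ≈.trans (split g)
      (≈.trans (map-cong {F x ×ᶠ Π Dom ys} {F x ×ᶠ Π F xs} (λ _ → refl) (at g∼g′ ys)) (≈.sym (split g′)))
      where
      split : ((y , γ) : Origin ℰ (F x)) →
        map {Π Dom (y ∷ ys)} {Π F (x ∷ xs)} (applyAll {ys = y ∷ ys} {x ∷ xs} (γ , γs)) (r (y ∷ ys)) ≈
        map {F x ×ᶠ Π Dom ys} {F x ×ᶠ Π F xs} (map₂ (applyAll γs))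
          (map {Dom y ×ᶠ Π Dom ys} {F x ×ᶠ Π Dom ys} (map₁ γ) (r (y ∷ ys)))
      split (y , γ) = map-∘ {Dom y ×ᶠ Π Dom ys} {F x ×ᶠ Π Dom ys} {F x ×ᶠ Π F xs}
        (map₂ (applyAll γs)) (map₁ γ) (r (y ∷ ys))

    -- After reindexing by `toFront i` the exchanged origin stands first and the others are
    -- unaffected, so `eval-cons` applies. The reindexing has a left inverse and can be cancelled.
    eval-replace : ∀ {xs} (t : Tuple xs) i {g} → g ∼ entry t i → eval (replace t i g) ≈ eval t
    eval-replace {xs} t i {g} g∼ = map-cancel R (reindex (toFront i) xs)
      (unreindex (toFront i) (toFront-surjective i) xs)
      (unreindex-reindex (toFront i) (toFront-surjective i) xs) (begin
      map (reindex (toFront i) xs) (eval (replace t i g))  ≈⟨ eval-select (toFront i) (replace t i g) ⟨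
      eval (cons (entry (replace t i g) i) (select others (replace t i g)))
        ≡⟨ cong₂ (λ h u → eval (cons h u)) (entry-replace-≡ t i g) (select-replace others t g i∉others) ⟩
      eval (cons g (select others t))                       ≈⟨ eval-cons (select others t) g∼ ⟩
      eval (cons (entry t i) (select others t))             ≈⟨ eval-select (toFront i) t ⟩
      map (reindex (toFront i) xs) (eval t)                 ∎)
      where
      open SetoidReasoning (obj (Π F (Vec.map (lookup xs) (toFront i))))
      others : Vec (Fin (suc k)) k
      others = tabulate (punchIn i)
      i∉others : ∀ l → lookup others l ≢ i
      i∉others l eq = Fin.punchInᵢ≢i i l (trans (sym (Vecₚ.lookup∘tabulate (punchIn i) l)) eq)

    -- The origins are exchanged from first to last. A general `f` in place of `eval` lets the
    -- induction shorten the tuple: origins already exchanged are absorbed into `f`.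
    replace-all : ∀ {s ℓₛ} (S : Setoid s ℓₛ) (let open Setoid S using () renaming (Carrier to ∣S∣; _≈_ to _≈ₛ_))
      {xs : Vec X n} (f : Tuple xs → ∣S∣) → (∀ t i {g} → g ∼ entry t i → f (replace t i g) ≈ₛ f t) →
      ∀ t u → (∀ i → entry t i ∼ entry u i) → f t ≈ₛ f u
    replace-all S {[]}    f f-replace ([] , _) ([] , _) t∼u = Setoid.refl S
    replace-all S {_ ∷ _} f f-replace (y ∷ ys , γ , γs) (y′ ∷ ys′ , γ′ , γs′) t∼u =
      -- The hypothesis is applied to the tuple that already has the new first origin; putting the
      -- old one back gives the original tuple.
      Setoid.trans S (f-replace (y′ ∷ ys , γ′ , γs) zero (t∼u zero))
        (replace-all S (f ∘ cons (y′ , γ′)) (λ v i → f-replace (cons (y′ , γ′) v) (suc i))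
          (ys , γs) (ys′ , γs′) (t∼u ∘ suc))

    eval-resp : ∀ {xs} (t u : Tuple xs) → (∀ i → entry t i ∼ entry u i) → eval t ≈ eval u
    eval-resp {xs} = replace-all (obj (Π F xs)) eval eval-replace

  module _ (𝒟 : LC) (origin : ∀ x → Origin ℰ (LC.Dom 𝒟 x))
           (origin-∼ : ∀ c → origin (LC.lhs 𝒟 c) ∼ (LC.fun 𝒟 c ⊚ origin (LC.rhs 𝒟 c))) where
    private
      𝒟ᵢ : LC
      𝒟ᵢ = withIdentities 𝒟
      open module 𝒟ᵢ = LC 𝒟ᵢ using (lhs; rhs; fun)
      Tuple′ : Vec ∣ 𝒟ᵢ.Var ∣ n → Set
      Tuple′ = Tuple {F = 𝒟ᵢ.Dom}

    origins : (xs : Vec ∣ 𝒟ᵢ.Var ∣ n) → Tuple′ xs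
    origins []       = [] , tt
    origins (x ∷ xs) = cons (origin x) (origins xs)

    entry-origins : ∀ (xs : Vec ∣ 𝒟ᵢ.Var ∣ n) i → entry (origins xs) i ≡ origin (lookup xs i)
    entry-origins (x ∷ xs) zero    = refl
    entry-origins (x ∷ xs) (suc i) = entry-origins xs i

    origins-select : ∀ (xs : Vec ∣ 𝒟ᵢ.Var ∣ n) (σ : Vec (Fin n) m) →
                     origins (Vec.map (lookup xs) σ) ≡ select σ (origins xs)
    origins-select xs []      = refl
    origins-select xs (i ∷ σ) = cong₂ cons (sym (entry-origins xs i)) (origins-select xs σ)

    funsMaps : ∀ (cs : Vec ∣ 𝒟ᵢ.Con ∣ n) {ys} → Maps {F = 𝒟ᵢ.Dom} ys (Vec.map rhs cs) →
               Maps {F = 𝒟ᵢ.Dom} ys (Vec.map lhs cs)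
    funsMaps []       {[]}    γs       = tt
    funsMaps (c ∷ cs) {_ ∷ _} (γ , γs) = fun c ∘ γ , funsMaps cs γs

    applyAll-funs : ∀ (cs : Vec ∣ 𝒟ᵢ.Con ∣ n) {ys} (γs : Maps ys (Vec.map rhs cs)) →
                    applyAll (funsMaps cs γs) ≗ funs 𝒟ᵢ cs ∘ applyAll γs
    applyAll-funs []       {[]}    γs       ds       = refl
    applyAll-funs (c ∷ cs) {_ ∷ _} (γ , γs) (d , ds) = cong (_ ,_) (applyAll-funs cs γs ds)

    funsTuple : ∀ (cs : Vec ∣ 𝒟ᵢ.Con ∣ n) → Tuple′ (Vec.map rhs cs) → Tuple′ (Vec.map lhs cs)
    funsTuple cs (ys , γs) = ys , funsMaps cs γs

    origins-∼ : ∀ (cs : Vec ∣ 𝒟ᵢ.Con ∣ n) i →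
                entry (origins (Vec.map lhs cs)) i ∼ entry (funsTuple cs (origins (Vec.map rhs cs))) i
    origins-∼ (inj₁ c ∷ cs) zero    = origin-∼ c
    origins-∼ (inj₂ x ∷ cs) zero    = ∼.refl
    origins-∼ (c ∷ cs)      (suc i) = origins-∼ cs i

    -- For constraints (2), choosing origins commutes with reindexing. For constraints (1), the
    -- origins of the left-hand sides are only related to those of the right-hand sides followed by
    -- the constraint maps; `eval-resp` bridges the gap.
    pushforward : Solvable (pow (suc k) 𝒟) R
    pushforward = eval ∘ origins , solves
      where
      solves : IsSolution (pow (suc k) 𝒟) R (eval ∘ origins)
      solves (inj₂ (xs , σ)) = ≈.trans (≈.reflexive (cong eval (origins-select xs σ))) (eval-select σ (origins xs))
      solves (inj₁ cs) = let (ys , γs) = origins (Vec.map rhs cs) in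
        ≈.trans (eval-resp (origins (Vec.map lhs cs)) (funsTuple cs (origins (Vec.map rhs cs))) (origins-∼ cs))
        (≈.trans (map-cong (applyAll-funs cs γs) ≈.refl) (map-∘ (funs 𝒟ᵢ cs) (applyAll γs) (r ys)))

-- Finite search and the free instance generated by a structure.

Boolᶠ : FinSet
Boolᶠ = record { Carrier = Bool ; size = 2 ; enum = ↔-sym Fin.2↔Bool }

module _ {𝕊} {𝔸 𝔹 : Structure 𝕊} where
  open Minion (ω (Pol 𝔸 𝔹))

  ω-≈? : ∀ {D} (p q : Elem D) → Dec (p ≈ q)
  ω-≈? {D} p q =
    FinSet.all? D (λ d → ωElem.subset p d ≟ᵇ ωElem.subset q d) ×-dec
    FinSet.all? (D ⇒ᶠ Structure.Universe 𝔸) λ a →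
      FinSet._≟_ (Structure.Universe 𝔹) (Hom.fun (ωElem.elem p) a) (Hom.fun (ωElem.elem q) a)

module _ {𝕊} (ℐ : Instance 𝕊) (𝔹 : Structure 𝕊) where
  open Instance ℐ
  open Structure 𝔹

  solution? : Dec (Solution ℐ 𝔹)
  solution? = map′
    (λ (s , p) → record { val = apply {Var} {Universe} s ; satisfied = p })
    (λ s → table {Var} {Universe} (Solution.val s) , λ c →
      subst (T ∘ rel (symb c))
        (Vecₚ.map-cong (λ x → sym (apply-table {Var} {Universe} (Solution.val s) x)) (args c))
        (Solution.satisfied s c))
    (FinSet.any? (Var ⇒ᶠ Universe) λ s → FinSet.all? Con λ c →
      T? (rel (symb c) (Vec.map (apply {Var} {Universe} s) (args c))))

  abstract

    someSolution : Solution ℐ 𝔹 → Solution ℐ 𝔹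
    someSolution s with solution?
    ... | yes s′ = s′
    ... | no ¬s  = contradiction s ¬s

    someSolution-const : ∀ s s′ → someSolution s ≡ someSolution s′
    someSolution-const s s′ with solution?
    ... | yes _ = refl
    ... | no ¬s = contradiction s ¬s

-- The pair (y , a) stands for the element of the level at A with origin (y , a); the table tells
-- which of these elements are equal.
module Free {𝕊} (𝔸 : Structure 𝕊) (ℰ : LC) where
  open Signature 𝕊
  open Structure 𝔸
  open LC ℰ using (Dom) renaming (Var to Y)

  Pairs : FinSet
  Pairs = Σᶠ Y λ y → Dom y ⇒ᶠ Universe

  Tuples : ∣ Symbol ∣ → FinSet
  Tuples R = sub (Vecᶠ Universe (ar R)) (rel R)

  Table : Set
  Table = ∣ (Pairs ×ᶠ Pairs) ⇒ᶠ Boolᶠ ∣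

  module _ (t : Table) where

    related : ∣ Pairs ×ᶠ Pairs ∣ → Bool
    related = apply {Pairs ×ᶠ Pairs} {Boolᶠ} t

    Related : FinSet
    Related = sub (Pairs ×ᶠ Pairs) related

    abstract
      variables : Quotient Pairs (Generator {Pairs} {∣ Related ∣} (proj₁ ∘ proj₁) (proj₂ ∘ proj₁))
      variables = generatedQuotient Pairs Related (proj₁ ∘ proj₁) (proj₂ ∘ proj₁)

    open Quotient variables

    -- A row is the map of an origin into the relation `R`; its projections are the maps of the
    -- origins that a constraint of the free instance relates.
    Rows : ∣ Symbol ∣ → ∣ Y ∣ → FinSet
    Rows R y = Dom y ⇒ᶠ Tuples R

    column : ∀ R y → ∣ Rows R y ∣ → Fin (ar R) → ∣ Dom y ∣ → ∣ Universe ∣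
    column R y a i d = lookup (proj₁ (apply {Dom y} {Tuples R} a d)) i

    columns : ∀ R y → ∣ Rows R y ∣ → Vec ∣ quotient ∣ (ar R)
    columns R y a = tabulate λ i → [ y , table {Dom y} {Universe} (column R y a i) ]

    free : Instance 𝕊
    free = record
      { Var  = quotient
      ; Con  = Σᶠ Symbol λ R → Σᶠ Y λ y → Rows R y
      ; symb = proj₁
      ; args = λ (R , y , a) → columns R y a
      }

    module _ {𝔹 : Structure 𝕊} (s : Solution free 𝔹) where
      open Solution s
      private
        module 𝔹 = Structure 𝔹

      -- The value at `a` is the one assigned to the class of `(y , a ∘ β)`. If `as` lies in `R`
      -- pointwise, its values at the points `β d` form a row, and the constraint of that row gives
      -- preservation.
      polymorphism : ∀ {C} y → (∣ Dom y ∣ → ∣ C ∣) → Hom (power 𝔸 C) 𝔹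
      polymorphism {C} y β = record
        { fun       = λ a → val [ y , precompose {Dom y} {C} {Universe} β a ]
        ; preserves = λ R as p →
            let rows = λ d → Vec.map (λ a → apply {C} {Universe} a (β d)) as , toWitness p (β d) in
            subst (T ∘ 𝔹.rel R) (args-rows R as rows (λ _ → refl))
              (satisfied (R , y , table {Dom y} {Tuples R} rows))
        }
        where
        args-rows : ∀ R (as : Vec ∣ C ⇒ᶠ Universe ∣ (ar R))
          (rows : ∣ Dom y ∣ → ∣ Tuples R ∣) →
          (∀ d → proj₁ (rows d) ≡ Vec.map (λ a → apply {C} {Universe} a (β d)) as) →
          Vec.map val (Instance.args free (R , y , table {Dom y} {Tuples R} rows)) ≡
          Vec.map (λ a → val [ y , precompose {Dom y} {C} {Universe} β a ]) as
        args-rows R as rows rows-as = trans (sym (Vecₚ.tabulate-∘ val _))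
          (trans (Vecₚ.tabulate-cong λ i → cong (λ a → val [ y , a ]) (table-cong {Dom y} {Universe} λ d →
                   trans (cong (λ row → lookup (proj₁ row) i) (apply-table {Dom y} {Tuples R} rows d))
                   (trans (cong (λ row → lookup row i) (rows-as d)) (Vecₚ.lookup-map i _ as))))
          (trans (Vecₚ.tabulate-∘ (λ a → val [ y , precompose {Dom y} {C} {Universe} β a ]) (lookup as))
                 (cong (Vec.map _) (Vecₚ.tabulate∘lookup as))))

-- The homomorphism from the level obtained from soundness.

module FreeInstance {c ℓ} {k : ℕ} {R : Minion c ℓ}
                    (≈? : ∀ {D} (p q : Minion.Elem R D) → Dec (Minion._≈_ R p q))
                    {𝕊} {𝔸 𝔹 : Structure 𝕊}
                    (solve : ∀ (ℐ : Instance 𝕊) → Solvable (pow (suc k) (lc 𝔸 ℐ)) R → Solution ℐ 𝔹) where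
  private
    A : FinSet
    A = Structure.Universe 𝔸

  open Minion R
  open LevelMinion k R
  open LevelAt

  module _ {ℰ : LC} where
    open Free 𝔸 ℰ

    value : ∀ t → Solution (free t) 𝔹 → ∣ Pairs ∣ → ∣ Structure.Universe 𝔹 ∣
    value t s v = Solution.val (someSolution (free t) 𝔹 s) (Quotient.[_] (variables t) v)

    value-cong : ∀ {t t′} → t ≡ t′ → ∀ s s′ v → value t s v ≡ value t′ s′ v
    value-cong {t} refl s s′ v =
      cong (λ s → Solution.val s (Quotient.[_] (variables t) v)) (someSolution-const (free t) 𝔹 s s′)

    value-related : ∀ t s {u v} → T (related t (u , v)) → value t s u ≡ value t s v
    value-related t s {u} {v} uv = cong (Solution.val (someSolution (free t) 𝔹 s))
      (Quotient.sound (variables t) (EqC.return (((u , v) , uv) , refl , refl)))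

  module Canonical {ℰ : LC} (r : Assignment (pow (suc k) ℰ) R) (r-solution : IsSolution (pow (suc k) ℰ) R r) where
    open LC ℰ using (Dom) renaming (Var to Y)
    open Free 𝔸 ℰ
    open Pushforward {R = R} {k} {ℰ} r r-solution

    tableOrigin : ∣ Pairs ∣ → Origin ℰ A
    tableOrigin (y , a) = y , apply {Dom y} {A} a

    ∼? : ∀ {D} (g h : Origin ℰ D) → Dec (g ∼ h)
    ∼? {D} (y , γ) (z , δ) = map′ at-all at (FinSet.all? (Vecᶠ Y k) λ ȳ → ≈? {D ×ᶠ Π Dom ȳ} _ _)

    isRelated : ∣ Pairs ×ᶠ Pairs ∣ → Bool
    isRelated (u , v) = isYes (∼? (tableOrigin u) (tableOrigin v))

    relatedBy : Table
    relatedBy = table {Pairs ×ᶠ Pairs} {Boolᶠ} isRelated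

    related⁺ : ∀ u v → tableOrigin u ∼ tableOrigin v → T (related relatedBy (u , v))
    related⁺ u v u∼v = subst T (sym (apply-table {Pairs ×ᶠ Pairs} {Boolᶠ} isRelated (u , v)))
      (fromWitness {a? = ∼? (tableOrigin u) (tableOrigin v)} u∼v)

    related⁻ : ∀ u v → T (related relatedBy (u , v)) → tableOrigin u ∼ tableOrigin v
    related⁻ u v uv = toWitness {a? = ∼? (tableOrigin u) (tableOrigin v)}
      (subst T (apply-table {Pairs ×ᶠ Pairs} {Boolᶠ} isRelated (u , v)) uv)

    open Quotient (variables relatedBy)

    -- The classes are those of a generated equivalence, but `_∼_` is already an equivalence, so
    -- nothing beyond it is identified.
    ∼-complete : ∀ {u v} → [ u ] ≡ [ v ] → tableOrigin u ∼ tableOrigin v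
    ∼-complete eq = EqC.gfold ∼-isEquivalence tableOrigin
      (λ { (((u , v) , uv) , refl , refl) → related⁻ u v uv }) (complete eq)

    freeLC : LC
    freeLC = lc 𝔸 (free relatedBy)

    -- A class of pairs has an origin only up to `_∼_`, so that of its representative is chosen. A
    -- constraint has its row as origin.
    origin : ∀ x → Origin ℰ (LC.Dom freeLC x)
    origin (inj₁ q)           = tableOrigin (rep q)
    origin (inj₂ (R , y , a)) = y , apply {Dom y} {Tuples R} a

    -- The representative of an argument may differ from the column that the argument came from, but
    -- both lie in one class.
    origin-∼ : ∀ c → origin (LC.lhs freeLC c) ∼ (LC.fun freeLC c ⊚ origin (LC.rhs freeLC c))
    origin-∼ ((R , y , a) , i) =
      subst (λ q → tableOrigin (rep q) ∼ (y , column relatedBy R y a i))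
        (sym (Vecₚ.lookup∘tabulate (λ j → [ y , table {Dom y} {A} (column relatedBy R y a j) ]) i))
        (∼.trans (∼-complete ([rep] [ y , table {Dom y} {A} (column relatedBy R y a i) ]))
                 (∼-pointwise (apply-table {Dom y} {A} (column relatedBy R y a i))))

    abstract
      free-solution : Solution (free relatedBy) 𝔹
      free-solution = solve (free relatedBy) (pushforward freeLC origin origin-∼)

    evaluate : ∣ Pairs ∣ → ∣ Structure.Universe 𝔹 ∣
    evaluate v = value {ℰ} relatedBy free-solution v

    pair : ∀ {C} → Origin ℰ C → ∣ C ⇒ᶠ A ∣ → ∣ Pairs ∣
    pair {C} (z , β) a = z , precompose {Dom z} {C} {A} β a

    abstract

      originPolymorphism : ∀ {C} → Origin ℰ C → Minion.Elem (Pol 𝔸 𝔹) C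
      originPolymorphism {C} (z , β) = polymorphism relatedBy (someSolution _ 𝔹 free-solution) {C} z β

      originPolymorphism-evaluate : ∀ {C} (o : Origin ℰ C) a →
        Hom.fun (originPolymorphism {C} o) a ≡ evaluate (pair {C} o a)
      originPolymorphism-evaluate _ _ = refl

    pair-⊚ : ∀ {C C′} (α : ∣ C ∣ → ∣ C′ ∣) (o : Origin ℰ C) a →
      pair {C′} (α ⊚ o) a ≡ pair {C} o (precompose {C} {C′} {A} α a)
    pair-⊚ {C} {C′} α (z , β) a = cong (z ,_)
      (table-cong {Dom z} {A} λ d → sym (apply-table {C} {A} (apply {C′} {A} a ∘ α) (β d)))

    -- The level acts on an element by composing its origin with `α`, so this is naturality of the
    -- homomorphism.
    originPolymorphism-⊚ : ∀ {C C′} (α : ∣ C ∣ → ∣ C′ ∣) (o : Origin ℰ C) a →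
      Hom.fun (originPolymorphism {C′} (α ⊚ o)) a ≡
      Hom.fun (originPolymorphism {C} o) (precompose {C} {C′} {A} α a)
    originPolymorphism-⊚ {C} {C′} α o a = trans (originPolymorphism-evaluate {C′} (α ⊚ o) a)
      (trans (cong evaluate (pair-⊚ {C} {C′} α o a)) (sym (originPolymorphism-evaluate {C} o _)))

  originOf : ∀ {C ℰ} → LevelAt C ℰ → Origin ℰ C
  originOf p = let (z , β , _) = w-origin p in z , β

  -- The origin recorded in `w-origin` is not determined by the triple; `ξ₀-cong` shows that the
  -- choice does not matter.
  ξ₀ : ∀ C → Elemˡ C → Minion.Elem (Pol 𝔸 𝔹) C
  ξ₀ C (ℰ , p) = Canonical.originPolymorphism {ℰ} (r p) (r-solution p) {C} (originOf p)

  module Compare {C : FinSet} {ℰ : LC} (p q : LevelAt C ℰ) (r-≈ : ∀ x̄ → r p x̄ ≈ r q x̄) where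
    open LC ℰ using (Dom)
    open Free 𝔸 ℰ using (Pairs; related)
    private
      module p where
        open Canonical {ℰ} (r p) (r-solution p) public
        open Pushforward {R = R} {k} {ℰ} (r p) (r-solution p) public
      module q where
        open Canonical {ℰ} (r q) (r-solution q) public
        open Pushforward {R = R} {k} {ℰ} (r q) (r-solution q) public

    ∼⇒∼ : ∀ {D} {g h : Origin ℰ D} → g p.∼ h → g q.∼ h
    ∼⇒∼ {D} {y , γ} {z , δ} g∼h = q.at-all λ ȳ →
      ≈.trans (map-cong {Dom y ×ᶠ Π Dom ȳ} {D ×ᶠ Π Dom ȳ} (λ _ → refl) (≈.sym (r-≈ (y ∷ ȳ))))
      (≈.trans (p.at g∼h ȳ)
               (map-cong {Dom z ×ᶠ Π Dom ȳ} {D ×ᶠ Π Dom ȳ} (λ _ → refl) (r-≈ (z ∷ ȳ))))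

    related⇒related : ∀ uv → T (p.isRelated uv) → T (q.isRelated uv)
    related⇒related (u , v) uv = fromWitness {a? = q.∼? (q.tableOrigin u) (q.tableOrigin v)}
      (∼⇒∼ (toWitness {a? = p.∼? (p.tableOrigin u) (p.tableOrigin v)} uv))

    relatedBy-≡ : (∀ uv → T (q.isRelated uv) → T (p.isRelated uv)) → p.relatedBy ≡ q.relatedBy
    relatedBy-≡ q⇒p = table-cong {Pairs ×ᶠ Pairs} {Boolᶠ} λ uv → T-ext (related⇒related uv) (q⇒p uv)

    module _ (w-≈ : ∀ ȳ → w p ȳ ≈ w q ȳ) where

      originOf-∼ : originOf p p.∼ originOf q
      originOf-∼ = let (z , β , w≈) = w-origin p; (z′ , β′ , w≈′) = w-origin q in p.at-all λ ȳ →
        ≈.trans (≈.sym (w≈ ȳ)) (≈.trans (w-≈ ȳ) (≈.trans (w≈′ ȳ)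
          (map-cong {Dom z′ ×ᶠ Π Dom ȳ} {C ×ᶠ Π Dom ȳ} (λ _ → refl) (≈.sym (r-≈ (z′ ∷ ȳ))))))

      pairs-∼ : ∀ a → p.tableOrigin (p.pair {C} (originOf p) a) p.∼
                      p.tableOrigin (p.pair {C} (originOf q) a)
      pairs-∼ a = p.∼.trans (p.∼-pointwise (apply-table {Dom (proj₁ (w-origin p))} {A} _))
                 (p.∼.trans (p.⊚-∼ (apply {C} {A} a) originOf-∼)
                 (p.∼-pointwise (λ d → sym (apply-table {Dom (proj₁ (w-origin q))} {A} _ d))))

      pairs-related : ∀ a → T (related p.relatedBy (p.pair {C} (originOf p) a , p.pair {C} (originOf q) a))
      pairs-related a = p.related⁺ (p.pair {C} (originOf p) a) (p.pair {C} (originOf q) a) (pairs-∼ a)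

  module _ {C ℰ} (p q : LevelAt C ℰ) (r-≈ : ∀ x̄ → r p x̄ ≈ r q x̄) (w-≈ : ∀ ȳ → w p ȳ ≈ w q ȳ) where
    private
      module p = Canonical {ℰ} (r p) (r-solution p)
      module q = Canonical {ℰ} (r q) (r-solution q)
      module pq = Compare {C} {ℰ} p q r-≈
      module qp = Compare {C} {ℰ} q p (λ x̄ → ≈.sym (r-≈ x̄))

    evaluate-related : ∀ a → p.evaluate (p.pair {C} (originOf p) a) ≡ p.evaluate (p.pair {C} (originOf q) a)
    evaluate-related a = value-related {ℰ} p.relatedBy p.free-solution
      {p.pair {C} (originOf p) a} {p.pair {C} (originOf q) a} (pq.pairs-related w-≈ a)

    evaluate-cong : ∀ v → p.evaluate v ≡ q.evaluate v
    evaluate-cong v = value-cong {ℰ} {p.relatedBy} {q.relatedBy} (pq.relatedBy-≡ qp.related⇒related)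
      p.free-solution q.free-solution v

    -- There are two stages: from the origin of `p` to that of `q` within the instance of `p`, then
    -- from this instance to that of `q`, which has the same table.
    ξ₀-≡ : ∀ a → Hom.fun (ξ₀ C (ℰ , p)) a ≡ Hom.fun (ξ₀ C (ℰ , q)) a
    ξ₀-≡ a = trans (p.originPolymorphism-evaluate {C} (originOf p) a) (trans (evaluate-related a)
      (trans (evaluate-cong (q.pair {C} (originOf q) a)) (sym (q.originPolymorphism-evaluate {C} (originOf q) a))))

  ξ₀-cong : ∀ {C} {u v : Elemˡ C} → u ≈ˡ v → Minion._≈_ (Pol 𝔸 𝔹) {C} (ξ₀ C u) (ξ₀ C v)
  ξ₀-cong {C} (triple {ℰ} {p} {q} r-≈ w-≈) = ξ₀-≡ {C} {ℰ} p q r-≈ w-≈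

  levelHom : MinionHom level (Pol 𝔸 𝔹)
  levelHom = record
    { ξ         = ξ₀
    ; ξ-cong    = λ {D} {u} {v} → ξ₀-cong {D} {u} {v}
    ; ξ-natural = λ {D} {E} α (ℰ , p) →
        Canonical.originPolymorphism-⊚ {ℰ} (r p) (r-solution p) {D} {E} α (originOf p)
    }

-- From a homomorphism on the level to solutions of the original label cover.

discretize : LC → LC
discretize 𝒟 = record { Var = Var ; Dom = Dom ; Con = 𝟘 ; lhs = λ () ; rhs = λ () ; fun = λ () }
  where open LC 𝒟

module _ {𝒟 : LC} where
  private
    𝒟ᵢ : LC
    𝒟ᵢ = withIdentities 𝒟
  open LC 𝒟ᵢ

  -- Such tuples are all the constraint tuples of a discrete instance, and they pad a single
  -- constraint to a tuple. Their two sides agree only propositionally, hence the transport in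
  -- `funs-identities`.
  data Identities : Vec ∣ Con ∣ n → Set where
    []  : Identities []
    _∷_ : ∀ x {cs : Vec ∣ Con ∣ n} → Identities cs → Identities (inj₂ x ∷ cs)

  identities : (xs : Vec ∣ Var ∣ n) → Identities (Vec.map inj₂ xs)
  identities []       = []
  identities (x ∷ xs) = x ∷ identities xs

  lhs-identities : (xs : Vec ∣ Var ∣ n) → Vec.map lhs (Vec.map inj₂ xs) ≡ xs
  lhs-identities xs = trans (sym (Vecₚ.map-∘ lhs inj₂ xs)) (Vecₚ.map-id xs)

  rhs≡lhs : {cs : Vec ∣ Con ∣ n} → Identities cs → Vec.map rhs cs ≡ Vec.map lhs cs
  rhs≡lhs []       = refl
  rhs≡lhs (x ∷ is) = cong (x ∷_) (rhs≡lhs is)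

  funs-identities : {cs : Vec ∣ Con ∣ n} → Identities cs → ∀ d →
    _≡_ {A = Σ (Vec ∣ Var ∣ n) (∣_∣ ∘ Π Dom)} (Vec.map rhs cs , d) (Vec.map lhs cs , funs 𝒟ᵢ cs d)
  funs-identities []       tt       = refl
  funs-identities (x ∷ is) (d , ds) = cong {A = Σ _ (∣_∣ ∘ Π Dom)} (λ (ys , es) → x ∷ ys , d , es) (funs-identities is ds)

discrete-identities : ∀ {𝒟} (cs : Vec ∣ LC.Con (withIdentities (discretize 𝒟)) ∣ n) → Identities {discretize 𝒟} cs
discrete-identities []                    = []
discrete-identities {𝒟 = 𝒟} (inj₂ x ∷ cs) = x ∷ discrete-identities {𝒟 = 𝒟} cs

module _ {R : Minion c ℓ} {𝒟 : LC} where
  open Minion R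
  open LC 𝒟

  discretize-solution : ∀ {n} (r : Assignment (pow n 𝒟) R) →
                        IsSolution (pow n 𝒟) R r → IsSolution (pow n (discretize 𝒟)) R r
  discretize-solution r r-solution (inj₂ (xs , σ)) = r-solution (inj₂ (xs , σ))
  discretize-solution r r-solution (inj₁ cs) = assignment-subst R {Dom = Dom} r
    (rhs≡lhs (discrete-identities {𝒟 = 𝒟} cs)) (funs (withIdentities (discretize 𝒟)) cs)
    (funs-identities (discrete-identities {𝒟 = 𝒟} cs))

  -- This is constraint (1) of the power for the tuple with `c` first and identities at the other
  -- coordinates.
  first-constraint : ∀ {k} (r : Assignment (pow (suc k) 𝒟) R) → IsSolution (pow (suc k) 𝒟) R r →
    ∀ c ȳ → r (lhs c ∷ ȳ) ≈
            map {Dom (rhs c) ×ᶠ Π Dom ȳ} {Dom (lhs c) ×ᶠ Π Dom ȳ} (map₁ (fun c)) (r (rhs c ∷ ȳ))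
  first-constraint {k} r r-solution c ȳ =
    straighten (lhs-identities {𝒟 = 𝒟} ȳ) (rhs≡lhs (identities {𝒟 = 𝒟} ȳ))
      (funs (withIdentities 𝒟) (Vec.map inj₂ ȳ)) (funs-identities (identities {𝒟 = 𝒟} ȳ))
      (r-solution (inj₁ (inj₁ c ∷ Vec.map inj₂ ȳ)))
    where
    -- The vectors `xs` and `zs` generalise mapped copies of `ȳ`, so that the equations can be
    -- matched.
    straighten : ∀ {xs zs} → xs ≡ ȳ → zs ≡ xs → (f : ∣ Π Dom zs ∣ → ∣ Π Dom xs ∣) →
      (∀ d → _≡_ {A = Σ (Vec ∣ Var ∣ k) (∣_∣ ∘ Π Dom)} (zs , d) (xs , f d)) →
      r (lhs c ∷ xs) ≈ map {Dom (rhs c) ×ᶠ Π Dom zs} {Dom (lhs c) ×ᶠ Π Dom xs}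
                         (λ (d , ds) → fun c d , f ds) (r (rhs c ∷ zs)) →
      r (lhs c ∷ ȳ) ≈ map {Dom (rhs c) ×ᶠ Π Dom ȳ} {Dom (lhs c) ×ᶠ Π Dom ȳ} (map₁ (fun c)) (r (rhs c ∷ ȳ))
    straighten refl refl f f≡ eq = ≈.trans eq
      (map-cong {Dom (rhs c) ×ᶠ Π Dom ȳ} {Dom (lhs c) ×ᶠ Π Dom ȳ}
        (λ (d , ds) → cong (fun c d ,_) (sym (same-fibre (f≡ ds)))) ≈.refl)

  module _ (k : ℕ) {S : Minion c′ ℓ′} (h : MinionHom (LevelMinion.level k R) S) where
    open MinionHom h
    open LevelMinion k R

    solvable-pow⇒solvable : Solvable (pow (suc k) 𝒟) R → Solvable 𝒟 S
    solvable-pow⇒solvable (r , r-solution) = (λ x → ξ (Dom x) (element x)) , λ c →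
      Minion.≈.trans S
        -- The element at `lhs c` and the image of the element at `rhs c` share `ℰ` and `r`; only
        -- their third components need comparing.
        (ξ-cong (triple {p = proj₂ (element (lhs c))}
                        {q = mapAt {Dom (rhs c)} {Dom (lhs c)} (fun c) (proj₂ (element (rhs c)))}
          (λ _ → ≈.refl) (first-constraint r r-solution c)))
        (ξ-natural (fun c) (element (rhs c)))
      where
      element : ∀ x → Elemˡ (Dom x)
      element x = discretize 𝒟 , record
        { discrete   = id
        ; r          = r
        ; r-solution = discretize-solution r r-solution
        ; w          = λ ȳ → r (x ∷ ȳ)
        ; w-origin   = x , id , λ ȳ → ≈.sym (map-id (r (x ∷ ȳ)))
        }

-- Reading off solutions from the label cover, and ordinary solutions by labels.

module _ {𝕊} {𝔸 𝔹 : Structure 𝕊} {ℐ : Instance 𝕊} where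
  open Instance ℐ
  open Structure 𝔸 using (Universe; rel)
  open Signature 𝕊

  -- A variable receives the value of its polymorphism at the identity tuple. The projections from a
  -- relation form a tuple of that relation in the power indexed by the relation itself, and the LC
  -- constraints identify its image with the values of the arguments.
  solvable-lc⇒solution : Solvable (lc 𝔸 ℐ) (Pol 𝔸 𝔹) → Solution ℐ 𝔹
  solvable-lc⇒solution (s , s-solution) = record
    { val       = val
    ; satisfied = λ c → subst (T ∘ Structure.rel 𝔹 (symb c)) (values c)
        (Hom.preserves (s (inj₂ c)) (symb c) (projections c)
          (fromWitness λ (t , p) → subst (T ∘ rel (symb c)) (sym (projections-apply c (t , p))) p))
    }
    where
    Tuples : ∣ Con ∣ → FinSet
    Tuples c = LC.Dom (lc 𝔸 ℐ) (inj₂ c)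

    val : ∣ Var ∣ → ∣ Structure.Universe 𝔹 ∣
    val x = Hom.fun (s (inj₁ x)) (table {Universe} {Universe} id)

    π : ∀ c → Fin (ar (symb c)) → ∣ Tuples c ∣ → ∣ Universe ∣
    π c i (t , _) = lookup t i

    projections : ∀ c → Vec ∣ Tuples c ⇒ᶠ Universe ∣ (ar (symb c))
    projections c = tabulate λ i → table {Tuples c} {Universe} (π c i)

    projections-apply : ∀ c t → Vec.map (λ a → apply {Tuples c} {Universe} a t) (projections c) ≡ proj₁ t
    projections-apply c t = trans (sym (Vecₚ.tabulate-∘ _ _))
      (trans (Vecₚ.tabulate-cong λ i → apply-table {Tuples c} {Universe} (π c i) t) (Vecₚ.tabulate∘lookup (proj₁ t)))

    val-lookup : ∀ c i → Hom.fun (s (inj₂ c)) (table {Tuples c} {Universe} (π c i)) ≡ val (lookup (args c) i)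
    val-lookup c i = sym (trans (s-solution (c , i) (table {Universe} {Universe} id))
      (cong (Hom.fun (s (inj₂ c))) (table-cong {Tuples c} {Universe} λ t → apply-table {Universe} {Universe} id (π c i t))))

    values : ∀ c → Vec.map (Hom.fun (s (inj₂ c))) (projections c) ≡ Vec.map val (args c)
    values c = trans (sym (Vecₚ.tabulate-∘ _ _)) (trans (Vecₚ.tabulate-cong (val-lookup c))
      (trans (Vecₚ.tabulate-∘ val (lookup (args c))) (cong (Vec.map val) (Vecₚ.tabulate∘lookup (args c)))))

-- Such choices of labels survive `lc`, `pow` and `arc`, and finally turn into projections, which
-- gives completeness.
LCSolution : LC → Set
LCSolution 𝒟 = Σ[ δ ∈ (∀ x → ∣ Dom x ∣) ] ∀ c → δ (lhs c) ≡ fun c (δ (rhs c))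
  where open LC 𝒟

lc-solution : ∀ {𝕊} {𝔸 : Structure 𝕊} {ℐ} → Solution ℐ 𝔸 → LCSolution (lc 𝔸 ℐ)
lc-solution {ℐ = ℐ} s =
    (λ { (inj₁ x) → val x ; (inj₂ c) → Vec.map val (args c) , satisfied c })
  , λ (c , i) → sym (Vecₚ.lookup-map i val (args c))
  where
  open Instance ℐ
  open Solution s

pow-solution : ∀ n {𝒟} → LCSolution 𝒟 → LCSolution (pow n 𝒟)
pow-solution n {𝒟} (δ , δ-solution) = δs , λ { (inj₁ cs) → δs-funs cs ; (inj₂ (xs , σ)) → δs-reindex xs σ }
  where
  open LC (withIdentities 𝒟)

  δs : ∀ {n} (xs : Vec ∣ Var ∣ n) → ∣ Π Dom xs ∣
  δs []       = tt
  δs (x ∷ xs) = δ x , δs xs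

  δs-funs : ∀ {n} (cs : Vec ∣ Con ∣ n) → δs (Vec.map lhs cs) ≡ funs (withIdentities 𝒟) cs (δs (Vec.map rhs cs))
  δs-funs []            = refl
  δs-funs (inj₁ c ∷ cs) = cong₂ _,_ (δ-solution c) (δs-funs cs)
  δs-funs (inj₂ x ∷ cs) = cong (δ x ,_) (δs-funs cs)

  δs-component : ∀ {n} (xs : Vec ∣ Var ∣ n) i → δ (lookup xs i) ≡ component {D = Dom} xs (δs xs) i
  δs-component (x ∷ xs) zero    = refl
  δs-component (x ∷ xs) (suc i) = δs-component xs i

  δs-reindex : ∀ {m n} (xs : Vec ∣ Var ∣ n) (σ : Vec (Fin n) m) →
               δs (Vec.map (lookup xs) σ) ≡ reindex {D = Dom} σ xs (δs xs)
  δs-reindex xs []      = refl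
  δs-reindex xs (i ∷ σ) = cong₂ _,_ (δs-component xs i) (δs-reindex xs σ)

-- The singletons of the chosen labels form an arc consistent family, so they lie within the largest
-- one.
arc-solution : ∀ {𝒟} → LCSolution 𝒟 → LCSolution (arc 𝒟)
arc-solution {𝒟} (δ , δ-solution) =
    (λ x → δ x , arcDom-largest 𝒟 {singletons} singletons-consistent x (δ x) (fromWitness refl))
  , λ c → sub-≡ {Dom (lhs c)} {arcDom 𝒟 (lhs c)} (δ-solution c)
  where
  open LC 𝒟

  singletons : Subdomains 𝒟
  singletons x d = isYes (FinSet._≟_ (Dom x) (δ x) d)

  singletons-consistent : ArcConsistent 𝒟 singletons
  singletons-consistent c d = T-ext
    (λ p → subst (T ∘ image {Dom (rhs c)} {Dom (lhs c)} (fun c) (singletons (rhs c)))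
      (trans (sym (δ-solution c)) (toWitness p))
      (∈-image⁺ {Dom (rhs c)} {Dom (lhs c)} {fun c} {singletons (rhs c)} (δ (rhs c)) (fromWitness refl)))
    (λ p → let (e , q , eq) = ∈-image⁻ {Dom (rhs c)} {Dom (lhs c)} {fun c} {singletons (rhs c)} d p in
      fromWitness (trans (δ-solution c) (trans (cong (fun c) (toWitness q)) eq)))

solution⇒solvable : ∀ {𝕊} {𝔸 : Structure 𝕊} {𝒟} → LCSolution 𝒟 → Solvable 𝒟 (Pol 𝔸 𝔸)
solution⇒solvable {𝔸 = 𝔸} {𝒟} (δ , δ-solution) =
    (λ x → record
      { fun       = λ a → apply {Dom x} {Universe} a (δ x)
      ; preserves = λ R as p → toWitness p (δ x)
      })
  , λ c a → trans (cong (apply {Dom (lhs c)} {Universe} a) (δ-solution c))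
      (sym (apply-table {Dom (rhs c)} {Universe} (apply {Dom (lhs c)} {Universe} a ∘ fun c) (δ (rhs c))))
  where
  open LC 𝒟
  open Structure 𝔸

-- Completeness and soundness of the reduction.

module Reduction {𝕊 𝕊′} (𝔸 𝔹 : Structure 𝕊) (𝔸′ : Structure 𝕊′) (k : ℕ) where

  complete : ∀ ℐ → Solution ℐ 𝔸′ → Solution (consistencyReduction (suc k) 𝔸′ 𝔸 ℐ) 𝔸
  complete ℐ s = solvable⇒csp {𝕊} {𝔸} {𝔸} {arc (pow (suc k) (lc 𝔸′ ℐ))}
    (solution⇒solvable {𝕊} {𝔸} {arc (pow (suc k) (lc 𝔸′ ℐ))}
      (arc-solution {pow (suc k) (lc 𝔸′ ℐ)} (pow-solution (suc k) {lc 𝔸′ ℐ} (lc-solution {𝕊′} {𝔸′} {ℐ} s))))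

  ♯-solution⇒solvable : ∀ ℐ → Solution (consistencyReduction (suc k) 𝔸′ 𝔸 ℐ) 𝔹 →
                        Solvable (pow (suc k) (lc 𝔸′ ℐ)) (ω (Pol 𝔸 𝔹))
  ♯-solution⇒solvable ℐ s = solvable-arc⇒solvable-ω {R = Pol 𝔸 𝔹} {pow (suc k) (lc 𝔸′ ℐ)}
    (csp⇒solvable {𝕊} {𝔸} {𝔹} {arc (pow (suc k) (lc 𝔸′ ℐ))} s)

  solvable⇒♯-solution : ∀ ℐ → Solvable (pow (suc k) (lc 𝔸′ ℐ)) (ω (Pol 𝔸 𝔹)) →
                        Solution (consistencyReduction (suc k) 𝔸′ 𝔸 ℐ) 𝔹
  solvable⇒♯-solution ℐ s = solvable⇒csp {𝕊} {𝔸} {𝔹} {arc (pow (suc k) (lc 𝔸′ ℐ))}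
    (solvable-ω⇒solvable-arc {R = Pol 𝔸 𝔹} {pow (suc k) (lc 𝔸′ ℐ)} s)

  sound⇒levelHom : ∀ {𝔹′} → (∀ ℐ → Solution (consistencyReduction (suc k) 𝔸′ 𝔸 ℐ) 𝔹 → Solution ℐ 𝔹′) →
                   MinionHom (lvl (suc k) (ω (Pol 𝔸 𝔹))) (Pol 𝔸′ 𝔹′)
  sound⇒levelHom {𝔹′} sound =
    FreeInstance.levelHom {k = k} {R = ω (Pol 𝔸 𝔹)} (λ {D} → ω-≈? {𝕊} {𝔸} {𝔹} {D}) {𝕊′} {𝔸′} {𝔹′}
      λ ℐ s → sound ℐ (solvable⇒♯-solution ℐ s)

  levelHom⇒sound : ∀ {𝔹′} → MinionHom (lvl (suc k) (ω (Pol 𝔸 𝔹))) (Pol 𝔸′ 𝔹′) →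
                   ∀ ℐ → Solution (consistencyReduction (suc k) 𝔸′ 𝔸 ℐ) 𝔹 → Solution ℐ 𝔹′
  levelHom⇒sound {𝔹′} h ℐ s = solvable-lc⇒solution {𝕊′} {𝔸′} {𝔹′} {ℐ}
    (solvable-pow⇒solvable {R = ω (Pol 𝔸 𝔹)} {lc 𝔸′ ℐ} k {Pol 𝔸′ 𝔹′} h (♯-solution⇒solvable ℐ s))

theorem6p14 : ∀ {𝕊 𝕊′ : Signature} (𝒯 : Template 𝕊) (𝒯′ : Template 𝕊′) (k : ℕ) → .{{_ : NonZero k}} →
    ReducesVia (consistencyReduction k (Template.𝔸 𝒯′) (Template.𝔸 𝒯)) 𝒯′ 𝒯
    ⇔ MinionHom (lvl k (ω (polymorphisms 𝒯))) (polymorphisms 𝒯′)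
theorem6p14 𝒯 𝒯′ (suc k) = mk⇔
  (λ reduces → sound⇒levelHom λ ℐ → proj₂ (reduces ℐ))
  (λ h ℐ → complete ℐ , levelHom⇒sound h ℐ)
  where open Reduction (Template.𝔸 𝒯) (Template.𝔹 𝒯) (Template.𝔸 𝒯′) k
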